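{- Let $H$ be a hamburger graph with $k$ pairs of distinguished vertices, let $M_H$ be its $2k\times 2k$ hamburger matrix, and let $c^+$ and $c^-$ be the numbers of positive and negative cycle systems in $H$, respectively. Then $\det M_H = c^+-c^-$.
   Context: All graphs are finite and directed. A hamburger graph $H$ consists of two vertex-disjoint acyclic directed graphs $G_1$ and $G_2$ and a connecting edge set $E_3$, as follows. $G_1$ has $k$ distinguished vertices $v_1,\dots,v_k$ such that there is a (nontrivial) directed path in $G_1$ from $v_i$ to $v_j$ only if $i<j$. $G_2$ has $k$ distinguished vertices $w_{k+1},\dots,w_{2k}$ such that there is a (nontrivial) directed path in $G_2$ from $w_i$ to $w_j$ only if $i>j$. $G_1$ and $G_2$ may have further, non-distinguished vertices. The set $E_3$ consists of exactly the edges $e_i: v_i\to w_{k+i}$ and $e_i': w_{k+i}\to v_i$ for $1\le i\le k$. No planarity is assumed. The hamburger matrix is the block matrix $$M_H=\begin{bmatrix} A & I_k\\ -I_k & B\end{bmatrix},$$ where $A=(a_{ij})$ is the upper triangular $k\times k$ matrix with $a_{ij}$ the number of directed paths from $v_i$ to $v_j$ in $G_1$, and $B=(b_{ij})$ is the lower triangular $k\times k$ matrix with $b_{ij}$ the number of directed paths from $w_{k+i}$ to $w_{k+j}$ in $G_2$. The trivial (length $0$) path is counted, so $a_{ii}=b_{ii}=1$. A cycle system $\mathcal C$ in $H$ is a (possibly empty) collection of pairwise vertex-disjoint directed cycles in $H$, where a cycle is a closed directed path with no repeated vertices (the 2-cycles $v_i\to w_{k+i}\to v_i$ are allowed). Let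 $l$ be the number of edges in $\mathcal C$ going from $G_2$ to $G_1$ and $m$ the number of cycles in $\mathcal C$. The cycle system is positive if $(-1)^{l+m}=+1$ and negative if $(-1)^{l+m}=-1$. -}

module Defs where

open import Data.Bool.Base using (if_then_else_)
open import Data.Empty using (⊥)
open import Data.Fin.Base using (Fin; zero; suc; toℕ; punchIn; _↑ˡ_; _↑ʳ_) renaming (_≤_ to _≤ᶠ_; _<_ to _<ᶠ_)
open import Data.Fin.Properties using (injective⇒≤) renaming (_≟_ to _≟ᶠ_; _≤?_ to _≤?ᶠ_)
open import Data.Integer.Base using (ℤ; 0ℤ; 1ℤ; -1ℤ; +_; -_; _*_; _^_)
open import Data.Integer.Properties using (+-*-semiring) renaming (_≟_ to _≟ℤ_)
open import Data.List.Base using (List; []; _∷_; _++_; map; filter; length; concat; lookup; allFin; cartesianProductWith)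
open import Data.List.Membership.Propositional using (_∈_)
open import Data.List.Membership.Propositional.Properties using (∈-allFin; ∈-filter⁺; ∈-cartesianProductWith⁺; ∈-cartesianProductWith⁻; ∈-lookup)
open import Data.List.Properties using (length-map)
open import Data.List.Relation.Binary.Disjoint.Propositional using (Disjoint)
open import Data.List.Relation.Unary.All using (All; all?) renaming (lookup to lookupAll; tabulate to tabulateAll)
open import Data.List.Relation.Unary.AllPairs using (AllPairs; allPairs?; []; _∷_)
open import Data.List.Relation.Unary.Any using (here; there)
open import Data.List.Relation.Unary.Unique.Propositional using (Unique)
open import Data.List.Relation.Unary.Unique.Propositional.Properties using (cartesianProductWith⁺; filter⁺; allFin⁺)
open import Data.Nat.Base using (ℕ; zero; suc; _+_; _≤_; _<_; s≤s)
open import Data.Nat.Properties using (_≤?_; _<?_)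
open import Data.Product.Base using (_×_; _,_)
open import Data.Unit.Base using (⊤; tt)
open import Data.Vec.Functional using (zipWith) renaming (_++_ to _++ᵛ_; map to mapᵛ)
open import Function.Definitions using (Injective)
open import Relation.Binary.PropositionalEquality using (_≡_; _≢_; refl; sym; cong; subst)
open import Relation.Nullary using (¬_; Dec; yes; no; does; contradiction; _×-dec_)
import Algebra.Properties.Semiring.Sum as Sum
import Data.List.Relation.Binary.Disjoint.DecPropositional as DecDisjoint
import Data.List.Relation.Unary.Unique.DecPropositional as DecUnique

private
  variable
    X : Set

listsUpTo : ℕ → List X → List (List X)
listsUpTo zero    xs = [] ∷ []
listsUpTo (suc n) xs = [] ∷ cartesianProductWith _∷_ xs (listsUpTo n xs)

sublists : List X → List (List X)
sublists []       = [] ∷ []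
sublists (x ∷ xs) = map (x ∷_) (sublists xs) ++ sublists xs

-- Parallel edges and loops are allowed here, so paths and cycles are
-- lists of edges rather than lists of vertices.
record Digraph : Set where
  field
    #V      : ℕ
    #E      : ℕ
    src tgt : Fin #E → Fin #V

  Vertex Edge : Set
  Vertex = Fin #V
  Edge   = Fin #E

module _ (G : Digraph) where
  open Digraph G

  IsWalk : Vertex → List Edge → Vertex → Set
  IsWalk u []       v = u ≡ v
  IsWalk u (e ∷ es) v = src e ≡ u × IsWalk (tgt e) es v

  IsPath : Vertex → List Edge → Vertex → Set
  IsPath u es v = IsWalk u es v × Unique (u ∷ map tgt es)

  IsCycle : List Edge → Set
  IsCycle []       = ⊥
  IsCycle (e ∷ es) = IsWalk (src e) (e ∷ es) (src e) × Unique (map src (e ∷ es))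

  Acyclic : Set
  Acyclic = ∀ es → ¬ IsCycle es

  -- A cycle has no distinguished starting point, so each cycle is
  -- represented by its rotation that starts at its least vertex; as the
  -- vertices of a cycle are distinct, there is exactly one such rotation.
  StartsAtLeast : List Edge → Set
  StartsAtLeast []       = ⊤
  StartsAtLeast (e ∷ es) = All (λ f → src e ≤ᶠ src f) es

  isWalk? : ∀ u es v → Dec (IsWalk u es v)
  isWalk? u []       v = u ≟ᶠ v
  isWalk? u (e ∷ es) v = (src e ≟ᶠ u) ×-dec isWalk? (tgt e) es v

  isPath? : ∀ u es v → Dec (IsPath u es v)
  isPath? u es v = isWalk? u es v ×-dec DecUnique.unique? _≟ᶠ_ (u ∷ map tgt es)

  isCycle? : ∀ es → Dec (IsCycle es)
  isCycle? []       = no λ ()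
  isCycle? (e ∷ es) =
    isWalk? (src e) (e ∷ es) (src e) ×-dec DecUnique.unique? _≟ᶠ_ (map src (e ∷ es))

  startsAtLeast? : ∀ es → Dec (StartsAtLeast es)
  startsAtLeast? []       = yes tt
  startsAtLeast? (e ∷ es) = all? (λ f → src e ≤?ᶠ src f) es

  -- No path or cycle has more than #V edges; that the two enumerations
  -- below are complete and without repetition is shown by ∈-paths,
  -- ∈-cycles, paths-unique and cycles-unique.
  paths : Vertex → Vertex → List (List Edge)
  paths u v = filter (λ es → isPath? u es v) (listsUpTo #V (allFin #E))

  #paths : Vertex → Vertex → ℕ
  #paths u v = length (paths u v)

  cycles : List (List Edge)
  cycles = filter (λ es → isCycle? es ×-dec startsAtLeast? es) (listsUpTo #V (allFin #E))

  VertexDisjoint : List Edge → List Edge → Set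
  VertexDisjoint c d = Disjoint (map src c) (map src d)

  vertexDisjoint? : ∀ c d → Dec (VertexDisjoint c d)
  vertexDisjoint? c d = DecDisjoint.disjoint? _≟ᶠ_ (map src c) (map src d)

  -- Since cycles has no repetitions, its sublists correspond one to one
  -- to the sets of cycles.
  cycleSystems : List (List (List Edge))
  cycleSystems = filter (allPairs? vertexDisjoint?) (sublists cycles)

module _ where
  private
    lookup-injective : {xs : List X} → Unique xs → Injective _≡_ _≡_ (lookup xs)
    lookup-injective {xs = x ∷ xs} (x∉ ∷ u) {zero}  {zero}  eq = refl
    lookup-injective {xs = x ∷ xs} (x∉ ∷ u) {zero}  {suc j} eq =
      contradiction eq (lookupAll x∉ (∈-lookup j))
    lookup-injective {xs = x ∷ xs} (x∉ ∷ u) {suc i} {zero}  eq =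
      contradiction (sym eq) (lookupAll x∉ (∈-lookup i))
    lookup-injective {xs = x ∷ xs} (x∉ ∷ u) {suc i} {suc j} eq =
      cong suc (lookup-injective u eq)

    length≤ : ∀ {n} {xs : List (Fin n)} → Unique xs → length xs ≤ n
    length≤ u = injective⇒≤ (lookup-injective u)

    ∈-listsUpTo : ∀ {n xs} {ys : List X} → (∀ y → y ∈ xs) → length ys ≤ n → ys ∈ listsUpTo n xs
    ∈-listsUpTo {n = zero}  {ys = []}     all _       = here refl
    ∈-listsUpTo {n = suc n} {ys = []}     all _       = here refl
    ∈-listsUpTo {n = suc n} {ys = y ∷ ys} all (s≤s p) =
      there (∈-cartesianProductWith⁺ _∷_ (all y) (∈-listsUpTo all p))

    listsUpTo-unique : ∀ n {xs : List X} → Unique xs → Unique (listsUpTo n xs)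
    listsUpTo-unique zero         u = tabulateAll (λ ()) ∷ []
    listsUpTo-unique (suc n) {xs} u =
      tabulateAll (λ y∈ → []≢ (∈-cartesianProductWith⁻ _∷_ xs (listsUpTo n xs) y∈))
      ∷ cartesianProductWith⁺ _∷_ (λ { refl → refl , refl }) u (listsUpTo-unique n u)
      where
      []≢ : ∀ {y} → _ → [] ≢ y
      []≢ (_ , _ , _ , _ , ()) refl

  module _ (G : Digraph) where
    open Digraph G

    ∈-paths : ∀ {u es v} → IsPath G u es v → es ∈ paths G u v
    ∈-paths {u} {es} {v} p@(_ , _ ∷ un) = ∈-filter⁺ (λ es → isPath? G u es v)
      (∈-listsUpTo ∈-allFin (subst (_≤ #V) (length-map tgt es) (length≤ un))) p

    ∈-cycles : ∀ {es} → IsCycle G es → StartsAtLeast G es → es ∈ cycles G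
    ∈-cycles {e ∷ es} c@(_ , un) s = ∈-filter⁺ (λ es → isCycle? G es ×-dec startsAtLeast? G es)
      (∈-listsUpTo ∈-allFin (subst (_≤ #V) (length-map src (e ∷ es)) (length≤ un))) (c , s)

    paths-unique : ∀ {u v} → Unique (paths G u v)
    paths-unique {u} {v} = filter⁺ (λ es → isPath? G u es v) (listsUpTo-unique #V (allFin⁺ #E))

    cycles-unique : Unique (cycles G)
    cycles-unique = filter⁺ (λ es → isCycle? G es ×-dec startsAtLeast? G es)
      (listsUpTo-unique #V (allFin⁺ #E))

-- The distinguished vertex w i stands for w_{k+i}.
record HamburgerGraph (k : ℕ) : Set where
  field
    G₁ G₂       : Digraph
    G₁-acyclic  : Acyclic G₁
    G₂-acyclic  : Acyclic G₂
    v           : Fin k → Digraph.Vertex G₁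
    w           : Fin k → Digraph.Vertex G₂
    v-injective : Injective _≡_ _≡_ v
    w-injective : Injective _≡_ _≡_ w
    v-order     : ∀ {i j es} → es ≢ [] → IsPath G₁ (v i) es (v j) → i <ᶠ j
    w-order     : ∀ {i j es} → es ≢ [] → IsPath G₂ (w i) es (w j) → j <ᶠ i

  private
    module G₁ = Digraph G₁
    module G₂ = Digraph G₂

  -- The vertices are those of G₁ followed by those of G₂; the edges are
  -- those of G₁, those of G₂, the eᵢ and the eᵢ′, in this order.
  graph : Digraph
  graph = record
    { #V  = G₁.#V + G₂.#V
    ; #E  = G₁.#E + (G₂.#E + (k + k))
    ; src = mapᵛ inG₁ G₁.src ++ᵛ mapᵛ inG₂ G₂.src ++ᵛ mapᵛ inG₁ v ++ᵛ mapᵛ inG₂ w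
    ; tgt = mapᵛ inG₁ G₁.tgt ++ᵛ mapᵛ inG₂ G₂.tgt ++ᵛ mapᵛ inG₂ w ++ᵛ mapᵛ inG₁ v
    }
    where
    inG₁ : G₁.Vertex → Fin (G₁.#V + G₂.#V)
    inG₁ = _↑ˡ G₂.#V
    inG₂ : G₂.Vertex → Fin (G₁.#V + G₂.#V)
    inG₂ = G₁.#V ↑ʳ_

  open Digraph graph public

  FromG₂ToG₁ : Edge → Set
  FromG₂ToG₁ e = G₁.#V ≤ toℕ (src e) × toℕ (tgt e) < G₁.#V

  fromG₂ToG₁? : ∀ e → Dec (FromG₂ToG₁ e)
  fromG₂ToG₁? e = (G₁.#V ≤? toℕ (src e)) ×-dec (toℕ (tgt e) <? G₁.#V)

  sign : List (List Edge) → ℤ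
  sign C = -1ℤ ^ (l + m)
    where
    l = length (filter fromG₂ToG₁? (concat C))
    m = length C

  c⁺ c⁻ : ℕ
  c⁺ = length (filter (λ C → sign C ≟ℤ 1ℤ) (cycleSystems graph))
  c⁻ = length (filter (λ C → sign C ≟ℤ -1ℤ) (cycleSystems graph))

Matrix : ℕ → Set
Matrix n = Fin n → Fin n → ℤ

open Sum +-*-semiring using (sum)

-- Laplace expansion along the first row.
det : ∀ {n} → Matrix n → ℤ
det {zero}  M = 1ℤ
det {suc n} M = sum λ j → -1ℤ ^ toℕ j * (M zero j * det (λ r c → M (suc r) (punchIn j c)))

I : ∀ {k} → Matrix k
I i j = if does (i ≟ᶠ j) then 1ℤ else 0ℤ

block : ∀ {k} → Matrix k → Matrix k → Matrix k → Matrix k → Matrix (k + k)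
block P Q R S = zipWith _++ᵛ_ P Q ++ᵛ zipWith _++ᵛ_ R S

hamburgerMatrix : ∀ {k} → HamburgerGraph k → Matrix (k + k)
hamburgerMatrix {k} H = block A I (λ i j → - I i j) B
  where
  open HamburgerGraph H
  A B : Matrix k
  A i j = + #paths G₁ (v i) (v j)
  B i j = + #paths G₂ (w i) (w j)

{-# OPTIONS --safe #-}
module Submission where

-- Give each edge from G₂ to G₁ the weight -1 and every other edge the weight 1,
-- and let W be the weighted adjacency matrix of H. Then c⁺ - c⁻ = det (I - W):
-- expanding the row of the least remaining vertex s, and then those of the
-- vertices reached from it, produces the cycles through s, just as sorting the
-- cycle systems by their cycle through s does. More generally, any alternating
-- form takes on the rows b_u - Σ_{e : u → x} ω_e b_x the value it has on the b_u,
-- times the sum over the cycle systems; that sum is 1 in an acyclic graph.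
--
-- It remains to eliminate the vertices in favour of the 2k distinguished ones.
-- Adjoin 2k vectors f_i, g_i to the basis vectors of the vertices and consider
-- the rows a_i = g_i - v_i, b_i = - f_i - w_i together with the rows of I - W.
-- Adding suitable a_i and b_i to the latter replaces the edges between G₁ and
-- G₂ by edges to the f_i and g_i, and the acyclic graphs G₁ and G₂ then reduce
-- the row of u to p_u = u + Σ_j #paths(u, v_j) f_j, respectively
-- p_u = u + Σ_j #paths(u, w_j) g_j. Adding p_{v_i} to a_i and p_{w_i} to b_i
-- leaves the rows of M_H in the basis (f, g).

open import Defs
open import Algebra.Properties.Semiring.Sum as Sum using ()
open import Data.Bool.Base using (if_then_else_)
open import Data.Fin.Base using (Fin; zero; suc; toℕ; fromℕ<; punchIn; pinch; _↑ˡ_; _↑ʳ_; splitAt; join) renaming (_≤_ to _≤ᶠ_)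
open import Data.Fin.Properties using (_≟_; suc-injective; toℕ-injective; toℕ<n; toℕ-fromℕ<; toℕ-↑ˡ; toℕ-↑ʳ; ↑ˡ-injective; ↑ʳ-injective; splitAt-↑ˡ; splitAt-↑ʳ; join-splitAt)
open import Data.Fin.Subset using (Subset; _∈_; _∉_; _⊆_; ∣_∣; ⁅_⁆) renaming (⊤ to full; _-_ to _⊝_)
open import Data.Fin.Subset.Properties using (_∈?_; x∈p∧x≢y⇒x∈p-y; x∈p⇒∣p-x∣<∣p∣; p─q⊆p; ⊆-antisym; ∈⊤; ∣p∣≤n)
open import Data.Integer using (+_; _-_)
open import Data.Integer.Base using (ℤ; 0ℤ; 1ℤ; -1ℤ; -_; _+_; _*_; _^_)
open import Data.Integer.Properties as ℤₚ using (+-*-semiring; +-identityˡ; +-identityʳ; +-comm; +-assoc; *-identityˡ; *-identityʳ; *-zeroˡ; *-zeroʳ; *-assoc; *-comm; *-distribˡ-+; neg-distribˡ-*; ^-distribˡ-+-*)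
open import Data.Integer.Tactic.RingSolver using (solve-∀)
open import Data.List.Base as List using (List; []; _∷_; _++_; map; filter; length; concat; allFin; cartesianProductWith; tabulate)
open import Data.List.Membership.Propositional using () renaming (_∈_ to _∈ˡ_; _∉_ to _∉ˡ_)
open import Data.List.Membership.Propositional.Properties using (∈-++⁺ˡ; ∈-++⁺ʳ; ∈-++⁻; ∈-map⁻; ∈-filter⁻)
open import Data.List.Properties using (length-map; length-++; filter-none; filter-++)
open import Data.List.Relation.Unary.All as All using (All; []; _∷_)
open import Data.List.Relation.Unary.All.Properties as Allₚ using ()
open import Data.List.Relation.Unary.AllPairs using (AllPairs; allPairs?; []; _∷_)
open import Data.List.Relation.Unary.AllPairs.Properties using () renaming (map⁺ to allPairs-map⁺)
open import Data.List.Relation.Unary.Any using (here; there)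
open import Data.List.Relation.Unary.Unique.Propositional using (Unique)
open import Data.List.Relation.Unary.Unique.Propositional.Properties using (concat⁺)
open import Data.Nat using (ℕ)
open import Data.Nat.Base as ℕ using (zero; suc)
open import Data.Product.Base using (_×_; _,_; proj₁; proj₂; ∃-syntax)
open import Data.Sum.Base using (_⊎_; inj₁; inj₂)
open import Data.Unit.Base using (⊤; tt)
open import Data.Vec.Base using () renaming (_∷_ to _∷ˢ_; there to thereˢ)
open import Data.Vec.Functional using (updateAt; tail; removeAt) renaming (_∷_ to _∷ᵛ_; _++_ to _++ᵛ_)
open import Data.Vec.Functional.Properties using (updateAt-updates; updateAt-minimal; lookup-++ˡ; lookup-++ʳ)
open import Function.Base using (_∘_; const; id)
open import Relation.Binary.PropositionalEquality using (_≡_; _≢_; refl; sym; trans; cong; cong₂; subst; module ≡-Reasoning)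
open import Relation.Nullary using (¬_; Dec; yes; no; does; contradiction; _×-dec_)
open import Relation.Nullary.Decidable using (dec-true; dec-false)
open import Relation.Unary using (Decidable)
import Data.List.Membership.DecPropositional as DecMembership
import Data.Nat.Properties as ℕₚ

open Sum +-*-semiring using (sum; sum-cong-≗; ∑-distrib-+; ∑-comm; *-distribˡ-sum; *-distribʳ-sum; sum-remove)

-- The rows to be reduced belong to different parts of one big matrix, and each reduction has to
-- leave the other rows alone.
--
-- The adjoined vectors replace a Schur complement, which would require the inverses of the blocks
-- of I - W that belong to G₁ and G₂. The path counts are the entries of these inverses, and the f_i
-- and g_i carry them into the rows without any division.
--
-- One value, that of the form on the rows of I - W together with the a_i and b_i, is computed in
-- two ways, through the cycles of H and through the paths of G₁ and G₂. Both results contain the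
-- value of the form on the basis vectors as a factor; for the determinant and the standard basis it
-- is 1.

private
  variable
    m n       : ℕ
    C P Q X Y : Set

-- Alternating forms

sum-zero : ∀ {n} {f : Fin n → ℤ} → (∀ i → f i ≡ 0ℤ) → sum f ≡ 0ℤ
sum-zero {zero}  f≡0 = refl
sum-zero {suc n} f≡0 = cong₂ _+_ (f≡0 zero) (sum-zero (f≡0 ∘ suc))

sum-linear : ∀ {n} a b (f g : Fin n → ℤ) →
             sum (λ i → a * f i + b * g i) ≡ a * sum f + b * sum g
sum-linear a b f g = trans (∑-distrib-+ (λ i → a * f i) (λ i → b * g i))
  (sym (cong₂ _+_ (*-distribˡ-sum a f) (*-distribˡ-sum b g)))

sum-neg : ∀ {n} (f : Fin n → ℤ) → sum (λ i → - f i) ≡ - sum f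
sum-neg {zero}  f = refl
sum-neg {suc n} f = trans (cong (_+_ (- f zero)) (sum-neg (f ∘ suc))) (lemma (f zero) (sum (f ∘ suc)))
  where
  lemma : ∀ x y → - x + - y ≡ - (x + y)
  lemma = solve-∀

_[_≔_] : (Fin m → C → ℤ) → Fin m → (C → ℤ) → Fin m → C → ℤ
M [ i ≔ x ] = updateAt M i (const x)

≔-updates : (M : Fin m → C → ℤ) (i : Fin m) {x : C → ℤ} → ∀ c → (M [ i ≔ x ]) i c ≡ x c
≔-updates M i c = cong (λ y → y c) (updateAt-updates i M)

≔-minimal : (M : Fin m → C → ℤ) (i : Fin m) {x : C → ℤ} → ∀ {r} → r ≢ i → ∀ c → (M [ i ≔ x ]) r c ≡ M r c
≔-minimal M i r≢i c = cong (λ y → y c) (updateAt-minimal _ i M r≢i)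

infix 4 _≋_ _≋[_]_

_≋_ : (M N : Fin m → C → ℤ) → Set
M ≋ N = ∀ r c → M r c ≡ N r c

_≋[_]_ : (Fin m → C → ℤ) → Fin m → (Fin m → C → ℤ) → Set
M ≋[ i ] N = ∀ {r} → r ≢ i → ∀ c → M r c ≡ N r c

≔-unique : {M N : Fin m → C → ℤ} {i : Fin m} {x : C → ℤ} →
           N ≋[ i ] M → (∀ c → N i c ≡ x c) → N ≋ M [ i ≔ x ]
≔-unique {M = M} {i = i} off at r c with r ≟ i
... | yes refl = trans (at c) (sym (≔-updates M i c))
... | no  r≢i  = trans (off r≢i c) (sym (≔-minimal M i r≢i c))

-- Matrices are compared entrywise, not by equality of functions: `cong-rows` is therefore a law of
-- its own, and `linear` speaks of three matrices that agree off row i instead of updates of a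
-- single one. The set of columns is arbitrary because freezing rows leaves fewer rows than columns.
record AltForm (m : ℕ) (C : Set) : Set where
  field
    ⟦_⟧         : (Fin m → C → ℤ) → ℤ
    cong-rows   : ∀ {M N} → M ≋ N → ⟦ M ⟧ ≡ ⟦ N ⟧
    linear      : ∀ i a b {M N P} → M ≋[ i ] P → N ≋[ i ] P →
                  (∀ c → P i c ≡ a * M i c + b * N i c) → ⟦ P ⟧ ≡ a * ⟦ M ⟧ + b * ⟦ N ⟧
    alternating : ∀ {i j M} → i ≢ j → (∀ c → M i c ≡ M j c) → ⟦ M ⟧ ≡ 0ℤ

  linear-≔ : ∀ i a b {P x y} → (∀ c → P i c ≡ a * x c + b * y c) →
             ⟦ P ⟧ ≡ a * ⟦ P [ i ≔ x ] ⟧ + b * ⟦ P [ i ≔ y ] ⟧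
  linear-≔ i a b {P} eq = linear i a b (≔-minimal P i) (≔-minimal P i)
    λ c → trans (eq c) (sym (cong₂ (λ s t → a * s + b * t) (≔-updates P i c) (≔-updates P i c)))

  zero-row : ∀ {i P} → (∀ c → P i c ≡ 0ℤ) → ⟦ P ⟧ ≡ 0ℤ
  zero-row {i} {P} eq = trans (linear i 0ℤ 0ℤ {P} {P} {P} (λ _ _ → refl) (λ _ _ → refl) λ c →
    trans (eq c) (sym (zeros (P i c)))) (zeros ⟦ P ⟧)
    where
    zeros : ∀ x → 0ℤ * x + 0ℤ * x ≡ 0ℤ
    zeros = solve-∀

  sum-row : ∀ {q} i (a : Fin q → ℤ) {P} (x : Fin q → C → ℤ) →
            (∀ c → P i c ≡ sum (λ j → a j * x j c)) →
            ⟦ P ⟧ ≡ sum (λ j → a j * ⟦ P [ i ≔ x j ] ⟧)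
  sum-row {zero}  i a     x eq = zero-row eq
  sum-row {suc q} i a {P} x eq = begin
    ⟦ P ⟧
      ≡⟨ linear-≔ i (a zero) 1ℤ {P} {x zero} {rest} (λ c → trans (eq c) (cong (_+_ (a zero * x zero c)) (sym (*-identityˡ (rest c))))) ⟩
    a zero * ⟦ P [ i ≔ x zero ] ⟧ + 1ℤ * ⟦ P [ i ≔ rest ] ⟧
      ≡⟨ cong (_+_ first) (trans (*-identityˡ _) (sum-row i (a ∘ suc) {P [ i ≔ rest ]} (x ∘ suc) (≔-updates P i))) ⟩
    a zero * ⟦ P [ i ≔ x zero ] ⟧ + sum (λ j → a (suc j) * ⟦ P [ i ≔ rest ] [ i ≔ x (suc j) ] ⟧)
      ≡⟨ cong (_+_ first) (sum-cong-≗ λ j → cong (a (suc j) *_) (cong-rows (overwrite j))) ⟩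
    a zero * ⟦ P [ i ≔ x zero ] ⟧ + sum (λ j → a (suc j) * ⟦ P [ i ≔ x (suc j) ] ⟧) ∎
    where
    open ≡-Reasoning
    first = a zero * ⟦ P [ i ≔ x zero ] ⟧
    rest = λ c → sum (λ j → a (suc j) * x (suc j) c)
    overwrite : ∀ j → P [ i ≔ rest ] [ i ≔ x (suc j) ] ≋ P [ i ≔ x (suc j) ]
    overwrite j = ≔-unique (λ r≢i c → trans (≔-minimal (P [ i ≔ rest ]) i r≢i c) (≔-minimal P i r≢i c))
      (≔-updates (P [ i ≔ rest ]) i)

  -- Polarisation: with x + y in both rows the form vanishes, and so it does with x or y in both;
  -- bilinearity leaves `β x y + β y x` equal to 0.
  antisym : ∀ {i j M N} → i ≢ j → (∀ {r} → r ≢ i → r ≢ j → ∀ c → M r c ≡ N r c) →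
            (∀ c → M i c ≡ N j c) → (∀ c → M j c ≡ N i c) → ⟦ M ⟧ ≡ - ⟦ N ⟧
  antisym {i} {j} {M} {N} i≢j off Mi Mj = begin
    ⟦ M ⟧           ≡⟨ cong-rows (β-unique (λ _ _ _ → refl) (λ _ → refl) (λ _ → refl)) ⟩
    β x y           ≡⟨ solved (β x y) (β y x) β-sum ⟩
    - β y x         ≡⟨ cong -_ (cong-rows (β-unique (λ r≢i r≢j c → sym (off r≢i r≢j c)) (sym ∘ Mj) (sym ∘ Mi))) ⟨
    - ⟦ N ⟧         ∎
    where
    open ≡-Reasoning
    j≢i = i≢j ∘ sym
    x = M i
    y = M j
    x+y : C → ℤ
    x+y c = 1ℤ * x c + 1ℤ * y c
    β-rows : (C → ℤ) → (C → ℤ) → Fin m → C → ℤ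
    β-rows s t = M [ i ≔ s ] [ j ≔ t ]
    β : (C → ℤ) → (C → ℤ) → ℤ
    β s t = ⟦ β-rows s t ⟧
    βi : ∀ s t c → β-rows s t i c ≡ s c
    βi s t c = trans (≔-minimal (M [ i ≔ s ]) j i≢j c) (≔-updates M i c)
    βj : ∀ s t c → β-rows s t j c ≡ t c
    βj s t c = ≔-updates (M [ i ≔ s ]) j c
    βo : ∀ s t {r} → r ≢ i → r ≢ j → ∀ c → β-rows s t r c ≡ M r c
    βo s t r≢i r≢j c = trans (≔-minimal (M [ i ≔ s ]) j r≢j c) (≔-minimal M i r≢i c)
    β-unique : ∀ {P s t} → (∀ {r} → r ≢ i → r ≢ j → ∀ c → P r c ≡ M r c) →
               (∀ c → P i c ≡ s c) → (∀ c → P j c ≡ t c) → P ≋ β-rows s t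
    β-unique {P} {s} {t} o Pi Pj r c with r ≟ i | r ≟ j
    ... | yes refl | _        = trans (Pi c) (sym (βi s t c))
    ... | no  _    | yes refl = trans (Pj c) (sym (βj s t c))
    ... | no  r≢i  | no  r≢j  = trans (o r≢i r≢j c) (sym (βo s t r≢i r≢j c))
    β-diag : ∀ s → β s s ≡ 0ℤ
    β-diag s = alternating i≢j λ c → trans (βi s s c) (sym (βj s s c))
    β-linʳ : ∀ s → β s x+y ≡ 1ℤ * β s x + 1ℤ * β s y
    β-linʳ s = linear j 1ℤ 1ℤ (agree x) (agree y) λ c →
      trans (βj s x+y c) (sym (cong₂ (λ p q → 1ℤ * p + 1ℤ * q) (βj s x c) (βj s y c)))
      where
      agree : ∀ t → β-rows s t ≋[ j ] β-rows s x+y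
      agree t r≢j c = trans (≔-minimal (M [ i ≔ s ]) j r≢j c) (sym (≔-minimal (M [ i ≔ s ]) j r≢j c))
    β-linˡ : ∀ t → β x+y t ≡ 1ℤ * β x t + 1ℤ * β y t
    β-linˡ t = linear i 1ℤ 1ℤ (agree x) (agree y) λ c →
      trans (βi x+y t c) (sym (cong₂ (λ p q → 1ℤ * p + 1ℤ * q) (βi x t c) (βi y t c)))
      where
      agree : ∀ s → β-rows s t ≋[ i ] β-rows x+y t
      agree s {r} r≢i c with r ≟ j
      ... | yes refl = trans (βj s t c) (sym (βj x+y t c))
      ... | no  r≢j  = trans (βo s t r≢i r≢j c) (sym (βo x+y t r≢i r≢j c))
    expand : ∀ p q r s → 1ℤ * (1ℤ * p + 1ℤ * q) + 1ℤ * (1ℤ * r + 1ℤ * s) ≡ (p + s) + (r + q)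
    expand = solve-∀
    β-sum : β y x + β x y ≡ 0ℤ
    β-sum = begin
      β y x + β x y                       ≡⟨ +-comm (β y x) (β x y) ⟩
      β x y + β y x                       ≡⟨ +-identityˡ _ ⟨
      0ℤ + (β x y + β y x)                ≡⟨ cong (_+ (β x y + β y x)) (cong₂ _+_ (β-diag x) (β-diag y)) ⟨
      (β x x + β y y) + (β x y + β y x)   ≡⟨ expand (β x x) (β y x) (β x y) (β y y) ⟨
      1ℤ * (1ℤ * β x x + 1ℤ * β y x) + 1ℤ * (1ℤ * β x y + 1ℤ * β y y)
        ≡⟨ cong₂ (λ p q → 1ℤ * p + 1ℤ * q) (β-linˡ x) (β-linˡ y) ⟨
      1ℤ * β x+y x + 1ℤ * β x+y y         ≡⟨ β-linʳ x+y ⟨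
      β x+y x+y                           ≡⟨ β-diag x+y ⟩
      0ℤ                                  ∎
    solved : ∀ p q → q + p ≡ 0ℤ → p ≡ - q
    solved p q eq = trans (regroup p q) (trans (cong (_+ - q) eq) (+-identityˡ _))
      where
      regroup : ∀ p q → p ≡ (q + p) + - q
      regroup = solve-∀

open AltForm

-- Forms with some rows frozen

∷-cong-rows : {x y : C → ℤ} {M N : Fin m → C → ℤ} → (∀ c → x c ≡ y c) → M ≋ N → (x ∷ᵛ M) ≋ (y ∷ᵛ N)
∷-cong-rows x≡y M≋N zero    = x≡y
∷-cong-rows x≡y M≋N (suc r) = M≋N r

fixHead : (C → ℤ) → AltForm (suc m) C → AltForm m C
⟦ fixHead x Φ ⟧ M = ⟦ Φ ⟧ (x ∷ᵛ M)
cong-rows (fixHead x Φ) eq = cong-rows Φ (∷-cong-rows (λ _ → refl) eq)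
linear (fixHead {C} x Φ) i a b M≋P N≋P = linear Φ (suc i) a b (agree M≋P) (agree N≋P)
  where
  agree : ∀ {M P} → M ≋[ i ] P → (x ∷ᵛ M) ≋[ suc i ] (x ∷ᵛ P)
  agree M≋P {zero}  r≢i c = refl
  agree M≋P {suc r} r≢i c = M≋P (r≢i ∘ cong suc) c
alternating (fixHead x Φ) i≢j = alternating Φ (i≢j ∘ suc-injective)

++-cong-rows : {M N : Fin m → C → ℤ} {P Q : Fin n → C → ℤ} → M ≋ N → P ≋ Q → (M ++ᵛ P) ≋ (N ++ᵛ Q)
++-cong-rows {m = m} M≋N P≋Q r c with splitAt m r
... | inj₁ i = M≋N i c
... | inj₂ j = P≋Q j c

++-at-↑ˡ : (M : Fin m → C → ℤ) (N : Fin n → C → ℤ) → ∀ i c → (M ++ᵛ N) (i ↑ˡ n) c ≡ M i c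
++-at-↑ˡ M N i c = cong (λ x → x c) (lookup-++ˡ M N i)

++-at-↑ʳ : (M : Fin m → C → ℤ) (N : Fin n → C → ℤ) → ∀ i c → (M ++ᵛ N) (m ↑ʳ i) c ≡ N i c
++-at-↑ʳ M N i c = cong (λ x → x c) (lookup-++ʳ M N i)

≋-by-blocks : {M N : Fin (m ℕ.+ n) → C → ℤ} → (∀ i c → M (i ↑ˡ n) c ≡ N (i ↑ˡ n) c) →
              (∀ i c → M (m ↑ʳ i) c ≡ N (m ↑ʳ i) c) → M ≋ N
≋-by-blocks {m = m} {n = n} {M = M} {N = N} l r i c =
  subst (λ i → M i c ≡ N i c) (join-splitAt m n i) (at (splitAt m i))
  where
  at : ∀ s → M (join m n s) c ≡ N (join m n s) c
  at (inj₁ i) = l i c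
  at (inj₂ i) = r i c

fixUpper : (Fin m → C → ℤ) → AltForm (m ℕ.+ n) C → AltForm n C
⟦ fixUpper M Φ ⟧ N = ⟦ Φ ⟧ (M ++ᵛ N)
cong-rows (fixUpper M Φ) eq = cong-rows Φ (++-cong-rows (λ _ _ → refl) eq)
linear (fixUpper {m = m} {n = n} M Φ) i a b {N} {P} {Q} N≋Q P≋Q eq =
  linear Φ (m ↑ʳ i) a b (agree N≋Q) (agree P≋Q) λ c →
    trans (++-at-↑ʳ M Q i c) (trans (eq c)
      (sym (cong₂ (λ p q → a * p + b * q) (++-at-↑ʳ M N i c) (++-at-↑ʳ M P i c))))
  where
  agree : ∀ {N Q} → N ≋[ i ] Q → (M ++ᵛ N) ≋[ m ↑ʳ i ] (M ++ᵛ Q)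
  agree N≋Q {r} r≢ c with splitAt m r | join-splitAt m n r
  ... | inj₁ _ | _  = refl
  ... | inj₂ j | eq = N≋Q (λ j≡i → r≢ (trans (sym eq) (cong (m ↑ʳ_) j≡i))) c
alternating (fixUpper {m = m} M Φ) {i} {j} {N} i≢j eq =
  alternating Φ (i≢j ∘ ↑ʳ-injective m i j) λ c →
    trans (++-at-↑ʳ M N i c) (trans (eq c) (sym (++-at-↑ʳ M N j c)))

fixLower : (Fin n → C → ℤ) → AltForm (m ℕ.+ n) C → AltForm m C
⟦ fixLower N Φ ⟧ M = ⟦ Φ ⟧ (M ++ᵛ N)
cong-rows (fixLower N Φ) eq = cong-rows Φ (++-cong-rows eq (λ _ _ → refl))
linear (fixLower {n = n} {m = m} N Φ) i a b {M} {P} {Q} M≋Q P≋Q eq =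
  linear Φ (i ↑ˡ n) a b (agree M≋Q) (agree P≋Q) λ c →
    trans (++-at-↑ˡ Q N i c) (trans (eq c)
      (sym (cong₂ (λ p q → a * p + b * q) (++-at-↑ˡ M N i c) (++-at-↑ˡ P N i c))))
  where
  agree : ∀ {M Q} → M ≋[ i ] Q → (M ++ᵛ N) ≋[ i ↑ˡ n ] (Q ++ᵛ N)
  agree M≋Q {r} r≢ c with splitAt m r | join-splitAt m n r
  ... | inj₁ j | eq = M≋Q (λ j≡i → r≢ (trans (sym eq) (cong (_↑ˡ n) j≡i))) c
  ... | inj₂ _ | _  = refl
alternating (fixLower {n = n} N Φ) {i} {j} {M} i≢j eq =
  alternating Φ (i≢j ∘ ↑ˡ-injective n i j) λ c →
    trans (++-at-↑ˡ M N i c) (trans (eq c) (sym (++-at-↑ˡ M N j c)))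

↑ˡ≢↑ʳ : ∀ (i : Fin m) (j : Fin n) → i ↑ˡ n ≢ m ↑ʳ j
↑ˡ≢↑ʳ {m} {n} i j eq with trans (sym (splitAt-↑ˡ m i n)) (trans (cong (splitAt m) eq) (splitAt-↑ʳ m n j))
... | ()

-- This is membership of z in the radical of the form. The radical is closed under linear
-- combinations and, for a form with frozen rows, contains those rows; row operations thus become
-- additions of negligible vectors.
record Negligible (Φ : AltForm m C) (z : C → ℤ) : Set where
  constructor negligible
  field vanishes : ∀ {i M} → (∀ c → M i c ≡ z c) → ⟦ Φ ⟧ M ≡ 0ℤ
open Negligible

negligible-sum : ∀ {Φ : AltForm m C} {q} (a : Fin q → ℤ) {z : Fin q → C → ℤ} →
                 (∀ j → Negligible Φ (z j)) → Negligible Φ (λ c → sum (λ j → a j * z j c))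
vanishes (negligible-sum {Φ = Φ} a {z} neg) {i} {M} eq =
  trans (sum-row Φ i a z eq) (sum-zero λ j →
    trans (cong (a j *_) (vanishes (neg j) (≔-updates M i))) (*-zeroʳ (a j)))

negligible-linear : ∀ {Φ : AltForm m C} a b {y z} → Negligible Φ y → Negligible Φ z →
                    Negligible Φ (λ c → a * y c + b * z c)
vanishes (negligible-linear {Φ = Φ} a b {y} {z} ny nz) {i} {M} eq =
  trans (linear-≔ Φ i a b eq) (trans
    (cong₂ (λ p q → a * p + b * q) (vanishes ny (≔-updates M i)) (vanishes nz (≔-updates M i)))
    (zeros a b))
  where
  zeros : ∀ a b → a * 0ℤ + b * 0ℤ ≡ 0ℤ
  zeros = solve-∀

negligible-scale : ∀ {Φ : AltForm m C} a {z} → Negligible Φ z → Negligible Φ (λ c → a * z c)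
vanishes (negligible-scale a nz) eq = vanishes (negligible-linear a 0ℤ nz nz) λ c →
  trans (eq c) (sym (+-identityʳ _))

negligible-head : (Φ : AltForm (suc m) C) (x : C → ℤ) → Negligible (fixHead x Φ) x
vanishes (negligible-head Φ x) {i} eq = alternating Φ {zero} {suc i} (λ ()) (sym ∘ eq)

negligible-upper : (Φ : AltForm (m ℕ.+ n) C) (M : Fin m → C → ℤ) → ∀ i → Negligible (fixUpper M Φ) (M i)
vanishes (negligible-upper {m = m} {n = n} Φ M i) {j} {N} eq = alternating Φ {i ↑ˡ n} {m ↑ʳ j} (↑ˡ≢↑ʳ i j)
  λ c → trans (++-at-↑ˡ M N i c) (sym (trans (++-at-↑ʳ M N j c) (eq c)))

negligible-lower : (Φ : AltForm (m ℕ.+ n) C) (N : Fin n → C → ℤ) → ∀ i → Negligible (fixLower N Φ) (N i)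
vanishes (negligible-lower {m = m} {n = n} Φ N j) {i} {M} eq = alternating Φ {i ↑ˡ n} {m ↑ʳ j} (↑ˡ≢↑ʳ i j)
  λ c → trans (++-at-↑ˡ M N i c) (trans (eq c) (sym (++-at-↑ʳ M N j c)))

-- All rows change at once. The top row is corrected by linearity and then frozen; a vector in the
-- radical stays there when a row is frozen, so the induction goes on with the rows below.
add-negligible : (Φ : AltForm m C) {M N Z : Fin m → C → ℤ} → (∀ i → Negligible Φ (Z i)) →
                 (∀ i c → N i c ≡ M i c + Z i c) → ⟦ Φ ⟧ N ≡ ⟦ Φ ⟧ M
add-negligible {m = zero}  Φ neg eq = cong-rows Φ λ ()
add-negligible {m = suc m} Φ {M} {N} {Z} neg eq = begin
  ⟦ Φ ⟧ N
    ≡⟨ linear-≔ Φ zero 1ℤ 1ℤ (λ c → trans (eq zero c) (sym (cong₂ _+_ (*-identityˡ (M zero c)) (*-identityˡ (Z zero c))))) ⟩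
  1ℤ * ⟦ Φ ⟧ (N [ zero ≔ M zero ]) + 1ℤ * ⟦ Φ ⟧ (N [ zero ≔ Z zero ])
    ≡⟨ cong₂ (λ p q → 1ℤ * p + 1ℤ * q) (cong-rows Φ first) (vanishes (neg zero) {i = zero} (λ _ → refl)) ⟩
  1ℤ * ⟦ Φ ⟧ (M zero ∷ᵛ tail N) + 1ℤ * 0ℤ
    ≡⟨ trans (+-identityʳ _) (*-identityˡ _) ⟩
  ⟦ Φ ⟧ (M zero ∷ᵛ tail N)
    ≡⟨ add-negligible (fixHead (M zero) Φ) (λ i → negligible λ {j} e → vanishes (neg (suc i)) {i = suc j} e) (eq ∘ suc) ⟩
  ⟦ Φ ⟧ (M zero ∷ᵛ tail M)
    ≡⟨ cong-rows Φ (λ { zero _ → refl ; (suc _) _ → refl }) ⟩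
  ⟦ Φ ⟧ M ∎
  where
  open ≡-Reasoning
  first : N [ zero ≔ M zero ] ≋ (M zero ∷ᵛ tail N)
  first zero    c = refl
  first (suc r) c = refl

-- With `h zero` frozen on top the induction brings the row to the second place; exchanging the top
-- two rows then contributes the last factor -1.
row-to-front : (Φ : AltForm (suc m) C) (h : Fin (suc m) → C → ℤ) (j : Fin (suc m)) →
               ⟦ Φ ⟧ (h j ∷ᵛ removeAt h j) ≡ -1ℤ ^ toℕ j * ⟦ Φ ⟧ h
row-to-front {m = m} Φ h zero = trans (cong-rows Φ λ { zero _ → refl ; (suc _) _ → refl }) (sym (*-identityˡ _))
row-to-front {m = suc m} Φ h (suc j) = begin
  ⟦ Φ ⟧ (h (suc j) ∷ᵛ removeAt h (suc j))
    ≡⟨ antisym Φ {zero} {suc zero} (λ ()) off (λ _ → refl) (λ _ → refl) ⟩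
  - ⟦ Φ ⟧ (h zero ∷ᵛ tail h j ∷ᵛ removeAt (tail h) j)
    ≡⟨ cong -_ (row-to-front (fixHead (h zero) Φ) (tail h) j) ⟩
  - (-1ℤ ^ toℕ j * ⟦ Φ ⟧ (h zero ∷ᵛ tail h))
    ≡⟨ cong (λ t → - (-1ℤ ^ toℕ j * t)) (cong-rows Φ λ { zero _ → refl ; (suc _) _ → refl }) ⟩
  - (-1ℤ ^ toℕ j * ⟦ Φ ⟧ h)
    ≡⟨ neg-mul (-1ℤ ^ toℕ j) (⟦ Φ ⟧ h) ⟩
  -1ℤ * -1ℤ ^ toℕ j * ⟦ Φ ⟧ h ∎
  where
  open ≡-Reasoning
  neg-mul : ∀ p q → - (p * q) ≡ -1ℤ * p * q
  neg-mul = solve-∀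
  off : ∀ {r} → r ≢ zero → r ≢ suc zero → ∀ c →
        (h (suc j) ∷ᵛ removeAt h (suc j)) r c ≡ (h zero ∷ᵛ tail h j ∷ᵛ removeAt (tail h) j) r c
  off {zero}        r≢0 r≢1 c = contradiction refl r≢0
  off {suc zero}    r≢0 r≢1 c = contradiction refl r≢1
  off {suc (suc r)} r≢0 r≢1 c = refl

-- Expanding the top row puts a single `h j` there. This vector is then negligible in the rows
-- below, which removes column j from them and leaves the minor of the Laplace expansion; moving
-- `h j` back to its place among the h yields the Laplace sign.
form-det : (Φ : AltForm m C) (h : Fin m → C → ℤ) (M : Matrix m) →
           ⟦ Φ ⟧ (λ i c → sum (λ j → M i j * h j c)) ≡ det M * ⟦ Φ ⟧ h
form-det {m = zero}  Φ h M = trans (cong-rows Φ λ ()) (sym (*-identityˡ _))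
form-det {m = suc m} Φ h M = begin
  ⟦ Φ ⟧ Mh
    ≡⟨ sum-row Φ zero (M zero) h (λ _ → refl) ⟩
  sum (λ j → M zero j * ⟦ Φ ⟧ (Mh [ zero ≔ h j ]))
    ≡⟨ sum-cong-≗ term ⟩
  sum (λ j → -1ℤ ^ toℕ j * (M zero j * det (minor j)) * ⟦ Φ ⟧ h)
    ≡⟨ *-distribʳ-sum (⟦ Φ ⟧ h) (λ j → -1ℤ ^ toℕ j * (M zero j * det (minor j))) ⟨
  det M * ⟦ Φ ⟧ h ∎
  where
  open ≡-Reasoning
  Mh : Fin (suc m) → _ → ℤ
  Mh i c = sum (λ j → M i j * h j c)
  minor : Fin (suc m) → Matrix m
  minor j r c = M (suc r) (punchIn j c)
  arrange : ∀ a b c d → a * (b * (c * d)) ≡ c * (a * b) * d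
  arrange = solve-∀
  term : ∀ j → M zero j * ⟦ Φ ⟧ (Mh [ zero ≔ h j ]) ≡ -1ℤ ^ toℕ j * (M zero j * det (minor j)) * ⟦ Φ ⟧ h
  term j = begin
    M zero j * ⟦ Φ ⟧ (Mh [ zero ≔ h j ])
      ≡⟨ cong (M zero j *_) (cong-rows Φ λ { zero _ → refl ; (suc _) _ → refl }) ⟩
    M zero j * ⟦ fixHead (h j) Φ ⟧ (tail Mh)
      ≡⟨ cong (M zero j *_) (add-negligible (fixHead (h j) Φ)
           (λ i → negligible-scale (M (suc i) j) (negligible-head Φ (h j)))
           λ i c → trans (sum-remove {i = j} (λ l → M (suc i) l * h l c))
             (+-comm (M (suc i) j * h j c) (sum (λ l → minor j i l * removeAt h j l c)))) ⟩
    M zero j * ⟦ fixHead (h j) Φ ⟧ (λ i c → sum (λ l → minor j i l * removeAt h j l c))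
      ≡⟨ cong (M zero j *_) (form-det (fixHead (h j) Φ) (removeAt h j) (minor j)) ⟩
    M zero j * (det (minor j) * ⟦ Φ ⟧ (h j ∷ᵛ removeAt h j))
      ≡⟨ cong (λ t → M zero j * (det (minor j) * t)) (row-to-front Φ h j) ⟩
    M zero j * (det (minor j) * (-1ℤ ^ toℕ j * ⟦ Φ ⟧ h))
      ≡⟨ arrange (M zero j) (det (minor j)) (-1ℤ ^ toℕ j) (⟦ Φ ⟧ h) ⟩
    -1ℤ ^ toℕ j * (M zero j * det (minor j)) * ⟦ Φ ⟧ h ∎

-- The determinant as an alternating form

-- (j , c) ↦ (punchIn j c , pinch c j) exchanges the two members of the pair
-- (j , punchIn j c) of distinct indices; punchIn-pinch and sign-pinch compare
-- the complements and the Laplace signs of a pair and of its exchange.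
punchIn-punchIn-pinch : ∀ {n} (j : Fin (suc n)) (c : Fin n) → punchIn (punchIn j c) (pinch c j) ≡ j
punchIn-punchIn-pinch {suc n} zero    c       = refl
punchIn-punchIn-pinch {suc n} (suc j) zero    = refl
punchIn-punchIn-pinch {suc n} (suc j) (suc c) = cong suc (punchIn-punchIn-pinch j c)

punchIn-pinch : ∀ {n} (j : Fin (suc (suc n))) (c : Fin (suc n)) (x : Fin n) →
                punchIn (punchIn j c) (punchIn (pinch c j) x) ≡ punchIn j (punchIn c x)
punchIn-pinch zero    c       x = refl
punchIn-pinch (suc j) zero    x = refl
punchIn-pinch (suc j) (suc c) zero    = refl
punchIn-pinch (suc j) (suc c) (suc x) = cong suc (punchIn-pinch j c x)

sign-pinch : ∀ {n} (j : Fin (suc n)) (c : Fin n) →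
             -1ℤ ^ toℕ (punchIn j c) * -1ℤ ^ toℕ (pinch c j) ≡ - (-1ℤ ^ toℕ j * -1ℤ ^ toℕ c)
sign-pinch {suc n} zero c = lemma (-1ℤ ^ toℕ c)
  where
  lemma : ∀ x → -1ℤ * x * 1ℤ ≡ - (1ℤ * x)
  lemma = solve-∀
sign-pinch {suc n} (suc j) zero = lemma (-1ℤ ^ toℕ j)
  where
  lemma : ∀ x → 1ℤ * x ≡ - (-1ℤ * x * 1ℤ)
  lemma = solve-∀
sign-pinch {suc n} (suc j) (suc c) = begin
  -1ℤ * p * (-1ℤ * q)   ≡⟨ lemma p q ⟩
  p * q                 ≡⟨ sign-pinch j c ⟩
  - (s * t)             ≡⟨ cong -_ (lemma s t) ⟨
  - (-1ℤ * s * (-1ℤ * t)) ∎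
  where
  open ≡-Reasoning
  p = -1ℤ ^ toℕ (punchIn j c)
  q = -1ℤ ^ toℕ (pinch c j)
  s = -1ℤ ^ toℕ j
  t = -1ℤ ^ toℕ c
  lemma : ∀ x y → -1ℤ * x * (-1ℤ * y) ≡ x * y
  lemma = solve-∀

-- The pairs that involve the index 0 are `(zero , c)` and `(suc c , zero)`. They are exchanged with
-- each other, so the first row of the double sum cancels against the first column of the rest. The
-- pairs that avoid 0 form the same situation one size down.
sum-antisymmetric : ∀ {n} (g : Fin (suc n) → Fin n → ℤ) →
                    (∀ j c → g (punchIn j c) (pinch c j) ≡ - g j c) →
                    sum (λ j → sum (g j)) ≡ 0ℤ
sum-antisymmetric {zero}  g anti = refl
sum-antisymmetric {suc n} g anti = begin
  sum (g zero) + sum (λ j → g (suc j) zero + sum (g (suc j) ∘ suc))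
    ≡⟨ cong (_+_ (sum (g zero))) (∑-distrib-+ (λ j → g (suc j) zero) (λ j → sum (g (suc j) ∘ suc))) ⟩
  sum (g zero) + (sum (λ j → g (suc j) zero) + sum (λ j → sum (g (suc j) ∘ suc)))
    ≡⟨ cong₂ (λ p q → sum (g zero) + (p + q)) (trans (sum-cong-≗ (anti zero)) (sum-neg (g zero)))
         (sum-antisymmetric (λ j c → g (suc j) (suc c)) (λ j c → anti (suc j) (suc c))) ⟩
  sum (g zero) + (- sum (g zero) + 0ℤ)
    ≡⟨ cancel (sum (g zero)) ⟩
  0ℤ ∎
  where
  open ≡-Reasoning
  cancel : ∀ x → x + (- x + 0ℤ) ≡ 0ℤ
  cancel = solve-∀

det-cong : {M N : Matrix n} → M ≋ N → det M ≡ det N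
det-cong {n = zero}  eq = refl
det-cong {n = suc n} eq = sum-cong-≗ λ j → cong₂ (λ x y → -1ℤ ^ toℕ j * (x * y)) (eq zero j)
  (det-cong λ r c → eq (suc r) (punchIn j c))

det-linear : ∀ i a b {M N P : Matrix n} → M ≋[ i ] P → N ≋[ i ] P →
             (∀ c → P i c ≡ a * M i c + b * N i c) → det P ≡ a * det M + b * det N
det-linear {n = suc n} i a b {M} {N} {P} M≋P N≋P eq =
  trans (sum-cong-≗ (term i M≋P N≋P eq)) (sum-linear a b (expand M) (expand N))
  where
  minor : Matrix (suc n) → Fin (suc n) → Matrix n
  minor M j r c = M (suc r) (punchIn j c)
  expand : Matrix (suc n) → Fin (suc n) → ℤ
  expand M j = -1ℤ ^ toℕ j * (M zero j * det (minor M j))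
  distribʳ : ∀ s a b x y d → s * ((a * x + b * y) * d) ≡ a * (s * (x * d)) + b * (s * (y * d))
  distribʳ = solve-∀
  distribˡ : ∀ s a b x d e → s * (x * (a * d + b * e)) ≡ a * (s * (x * d)) + b * (s * (x * e))
  distribˡ = solve-∀
  open ≡-Reasoning
  term : ∀ i → M ≋[ i ] P → N ≋[ i ] P → (∀ c → P i c ≡ a * M i c + b * N i c) →
         ∀ j → expand P j ≡ a * expand M j + b * expand N j
  term zero M≋P N≋P eq j = begin
    expand P j
      ≡⟨ cong (λ x → -1ℤ ^ toℕ j * (x * det (minor P j))) (eq j) ⟩
    -1ℤ ^ toℕ j * ((a * M zero j + b * N zero j) * det (minor P j))
      ≡⟨ distribʳ (-1ℤ ^ toℕ j) a b (M zero j) (N zero j) (det (minor P j)) ⟩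
    a * (-1ℤ ^ toℕ j * (M zero j * det (minor P j))) + b * (-1ℤ ^ toℕ j * (N zero j * det (minor P j)))
      ≡⟨ cong₂ (λ d e → a * (-1ℤ ^ toℕ j * (M zero j * d)) + b * (-1ℤ ^ toℕ j * (N zero j * e)))
           (det-cong λ r c → M≋P (λ ()) (punchIn j c)) (det-cong λ r c → N≋P (λ ()) (punchIn j c)) ⟨
    a * expand M j + b * expand N j ∎
  term (suc i) M≋P N≋P eq j = begin
    expand P j
      ≡⟨ cong (λ d → -1ℤ ^ toℕ j * (P zero j * d)) (det-linear i a b
           (λ r≢i c → M≋P (r≢i ∘ suc-injective) (punchIn j c))
           (λ r≢i c → N≋P (r≢i ∘ suc-injective) (punchIn j c))
           (λ c → eq (punchIn j c))) ⟩
    -1ℤ ^ toℕ j * (P zero j * (a * det (minor M j) + b * det (minor N j)))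
      ≡⟨ distribˡ (-1ℤ ^ toℕ j) a b (P zero j) (det (minor M j)) (det (minor N j)) ⟩
    a * (-1ℤ ^ toℕ j * (P zero j * det (minor M j))) + b * (-1ℤ ^ toℕ j * (P zero j * det (minor N j)))
      ≡⟨ cong₂ (λ x y → a * (-1ℤ ^ toℕ j * (x * det (minor M j))) + b * (-1ℤ ^ toℕ j * (y * det (minor N j))))
           (M≋P (λ ()) j) (N≋P (λ ()) j) ⟨
    a * expand M j + b * expand N j ∎

-- Expanding the first two rows gives a sum over the ordered pairs of distinct columns. Exchanging
-- the columns of a pair preserves the product of the two entries and the complementary minor, and
-- reverses the sign.
det-first-rows-equal : (M : Matrix (suc (suc n))) → (∀ c → M zero c ≡ M (suc zero) c) → det M ≡ 0ℤ
det-first-rows-equal {n = n} M eq = trans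
  (sum-cong-≗ λ j → trans (sym (*-assoc (s j) (M zero j) (det (minor j))))
    (*-distribˡ-sum (s j * M zero j) λ c → s c * (M (suc zero) (punchIn j c) * det (minor₂ j c))))
  (sum-antisymmetric g anti)
  where
  open ≡-Reasoning
  s : ∀ {k} → Fin k → ℤ
  s c = -1ℤ ^ toℕ c
  minor : Fin (suc (suc n)) → Matrix (suc n)
  minor j r c = M (suc r) (punchIn j c)
  minor₂ : Fin (suc (suc n)) → Fin (suc n) → Matrix n
  minor₂ j c r x = M (suc (suc r)) (punchIn j (punchIn c x))
  g : Fin (suc (suc n)) → Fin (suc n) → ℤ
  g j c = s j * M zero j * (s c * (M (suc zero) (punchIn j c) * det (minor₂ j c)))
  arrange : ∀ a b c d e → a * b * (c * (d * e)) ≡ (a * c) * (b * d * e)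
  arrange = solve-∀
  arrange′ : ∀ a c b d e → - (a * c) * (d * b * e) ≡ - (a * b * (c * (d * e)))
  arrange′ = solve-∀
  anti : ∀ j c → g (punchIn j c) (pinch c j) ≡ - g j c
  anti j c = begin
    g j′ c′
      ≡⟨ arrange (s j′) (M zero j′) (s c′) (M (suc zero) (punchIn j′ c′)) (det (minor₂ j′ c′)) ⟩
    (s j′ * s c′) * (M zero j′ * M (suc zero) (punchIn j′ c′) * det (minor₂ j′ c′))
      ≡⟨ cong₂ _*_ (sign-pinch j c) (cong₂ _*_
           (cong₂ _*_ (eq j′) (trans (cong (M (suc zero)) (punchIn-punchIn-pinch j c)) (sym (eq j))))
           (det-cong λ r x → cong (M (suc (suc r))) (punchIn-pinch j c x))) ⟩
    - (s j * s c) * (M (suc zero) j′ * M zero j * det (minor₂ j c))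
      ≡⟨ arrange′ (s j) (s c) (M zero j) (M (suc zero) j′) (det (minor₂ j c)) ⟩
    - g j c ∎
    where
    j′ = punchIn j c
    c′ = pinch c j

-- Alternation is proved by induction on the size, and the inductive step already uses `antisym` for
-- the minors. The smaller case is therefore passed as a hypothesis, from which `detForm′` builds a
-- form.
DetAlternating : ℕ → Set
DetAlternating n = ∀ {i j} {M : Matrix n} → i ≢ j → (∀ c → M i c ≡ M j c) → det M ≡ 0ℤ

detForm′ : DetAlternating n → AltForm n (Fin n)
detForm′ alt = record
  { ⟦_⟧         = det
  ; cong-rows   = det-cong
  ; linear      = det-linear
  ; alternating = alt
  }

-- Exchanging rows 1 and j + 2 reduces the case of the rows 0 and j + 2 to
-- det-first-rows-equal.
det-head-alternating : DetAlternating n → ∀ (j : Fin n) (M : Matrix (suc n)) →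
                       (∀ c → M zero c ≡ M (suc j) c) → det M ≡ 0ℤ
det-head-alternating alt zero M eq = det-first-rows-equal M eq
det-head-alternating {suc n} alt (suc j) M eq = begin
  det M                      ≡⟨ sum-cong-≗ exchange ⟩
  sum (λ c → - expand c)     ≡⟨ sum-neg expand ⟩
  - det M′                   ≡⟨ cong -_ (det-first-rows-equal M′ eq) ⟩
  0ℤ                         ∎
  where
  open ≡-Reasoning
  M′ : Matrix (suc (suc n))
  M′ = M zero ∷ᵛ M (suc (suc j)) ∷ᵛ (tail (tail M) [ j ≔ M (suc zero) ])
  expand : Fin (suc (suc n)) → ℤ
  expand c = -1ℤ ^ toℕ c * (M′ zero c * det (λ r x → M′ (suc r) (punchIn c x)))
  neg-out : ∀ x y z → x * (y * - z) ≡ - (x * (y * z))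
  neg-out = solve-∀
  exchange : ∀ c → -1ℤ ^ toℕ c * (M zero c * det (λ r x → M (suc r) (punchIn c x))) ≡ - expand c
  exchange c = trans (cong (λ d → -1ℤ ^ toℕ c * (M zero c * d))
      (antisym (detForm′ alt) {zero} {suc j} (λ ()) off
        (λ x → sym (≔-updates (tail (tail M)) j (punchIn c x))) (λ x → refl)))
    (neg-out (-1ℤ ^ toℕ c) (M zero c) (det (λ r x → M′ (suc r) (punchIn c x))))
    where
    off : ∀ {r} → r ≢ zero → r ≢ suc j → ∀ x → M (suc r) (punchIn c x) ≡ M′ (suc r) (punchIn c x)
    off {zero}  r≢0 r≢j x = contradiction refl r≢0
    off {suc r} r≢0 r≢j x = sym (≔-minimal (tail (tail M)) j (r≢j ∘ cong suc) (punchIn c x))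

det-alternating : DetAlternating n
det-alternating {suc n} {zero}  {zero}      i≢j eq = contradiction refl i≢j
det-alternating {suc n} {suc i} {zero}  {M} i≢j eq = det-head-alternating det-alternating i M (sym ∘ eq)
det-alternating {suc n} {zero}  {suc j} {M} i≢j eq = det-head-alternating det-alternating j M eq
det-alternating {suc n} {suc i} {suc j} {M} i≢j eq = sum-zero λ c →
  trans (cong (λ d → -1ℤ ^ toℕ c * (M zero c * d)) (det-alternating {n} {i} {j} (i≢j ∘ cong suc) λ x → eq (punchIn c x)))
    (zeros (-1ℤ ^ toℕ c) (M zero c))
  where
  zeros : ∀ x y → x * (y * 0ℤ) ≡ 0ℤ
  zeros = solve-∀

detForm : ∀ n → AltForm n (Fin n)
detForm n = detForm′ det-alternating

det-identity : ∀ n → det {n} I ≡ 1ℤ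
det-identity zero    = refl
det-identity (suc n) = cong₂ _+_ first (sum-zero {n} λ j →
  zeros (-1ℤ * -1ℤ ^ toℕ j) (det (λ r c → I {suc n} (suc r) (punchIn (suc j) c))))
  where
  minor₀ : (λ r c → I (suc r) (suc c)) ≋ I {n}
  minor₀ r c with r ≟ c
  ... | yes _ = refl
  ... | no  _ = refl
  first : 1ℤ * (1ℤ * det (λ r c → I {suc n} (suc r) (suc c))) ≡ 1ℤ
  first = cong (λ d → 1ℤ * (1ℤ * d)) (trans (det-cong minor₀) (det-identity n))
  zeros : ∀ x y → x * (0ℤ * y) ≡ 0ℤ
  zeros = solve-∀

-- Sums over lists

𝟙 : Dec P → ℤ
𝟙 p = if does p then 1ℤ else 0ℤ

𝟙-yes : (p : Dec P) → P → 𝟙 p ≡ 1ℤ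
𝟙-yes (yes _) p = refl
𝟙-yes (no ¬p) p = contradiction p ¬p

𝟙-no : (p : Dec P) → ¬ P → 𝟙 p ≡ 0ℤ
𝟙-no (yes p) ¬p = contradiction p ¬p
𝟙-no (no _)  ¬p = refl

𝟙-cong : {p : Dec P} {q : Dec Q} → (P → Q) → (Q → P) → 𝟙 p ≡ 𝟙 q
𝟙-cong {p = yes p} {q} to from = sym (𝟙-yes q (to p))
𝟙-cong {p = no ¬p} {q} to from = sym (𝟙-no q (¬p ∘ from))

𝟙-× : (p : Dec P) (q : Dec Q) → 𝟙 (p ×-dec q) ≡ 𝟙 p * 𝟙 q
𝟙-× (yes _) q = sym (*-identityˡ (𝟙 q))
𝟙-× (no _)  q = refl

𝟙-guard : (p : Dec P) {x y : ℤ} → (P → x ≡ y) → 𝟙 p * x ≡ 𝟙 p * y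
𝟙-guard (yes p) eq = cong (1ℤ *_) (eq p)
𝟙-guard (no _)  eq = refl

sumOver : List X → (X → ℤ) → ℤ
sumOver []       f = 0ℤ
sumOver (x ∷ xs) f = f x + sumOver xs f

sumOver-cong-∈ : ∀ (xs : List X) {f g : X → ℤ} → (∀ {x} → x ∈ˡ xs → f x ≡ g x) → sumOver xs f ≡ sumOver xs g
sumOver-cong-∈ []       eq = refl
sumOver-cong-∈ (x ∷ xs) eq = cong₂ _+_ (eq (here refl)) (sumOver-cong-∈ xs (eq ∘ there))

sumOver-cong : ∀ (xs : List X) {f g : X → ℤ} → (∀ x → f x ≡ g x) → sumOver xs f ≡ sumOver xs g
sumOver-cong xs eq = sumOver-cong-∈ xs λ {x} _ → eq x

sumOver-zero : ∀ (xs : List X) {f : X → ℤ} → (∀ x → f x ≡ 0ℤ) → sumOver xs f ≡ 0ℤ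
sumOver-zero []       eq = refl
sumOver-zero (x ∷ xs) eq = cong₂ _+_ (eq x) (sumOver-zero xs eq)

sumOver-linear : ∀ a b (xs : List X) (f g : X → ℤ) →
                 sumOver xs (λ x → a * f x + b * g x) ≡ a * sumOver xs f + b * sumOver xs g
sumOver-linear a b []       f g = sym (cong₂ _+_ (*-zeroʳ a) (*-zeroʳ b))
sumOver-linear a b (x ∷ xs) f g = trans (cong (_+_ (a * f x + b * g x)) (sumOver-linear a b xs f g))
  (lemma a b (f x) (g x) (sumOver xs f) (sumOver xs g))
  where
  lemma : ∀ a b p q s t → a * p + b * q + (a * s + b * t) ≡ a * (p + s) + b * (q + t)
  lemma = solve-∀

sumOver-*ˡ : ∀ a (xs : List X) (f : X → ℤ) → sumOver xs (λ x → a * f x) ≡ a * sumOver xs f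
sumOver-*ˡ a []       f = sym (*-zeroʳ a)
sumOver-*ˡ a (x ∷ xs) f = trans (cong (_+_ (a * f x)) (sumOver-*ˡ a xs f)) (sym (*-distribˡ-+ a (f x) (sumOver xs f)))

sumOver-*ʳ : ∀ a (xs : List X) (f : X → ℤ) → sumOver xs (λ x → f x * a) ≡ sumOver xs f * a
sumOver-*ʳ a xs f = trans (sumOver-cong xs λ x → *-comm (f x) a) (trans (sumOver-*ˡ a xs f) (*-comm a (sumOver xs f)))

sumOver-++ : ∀ (xs ys : List X) (f : X → ℤ) → sumOver (xs ++ ys) f ≡ sumOver xs f + sumOver ys f
sumOver-++ []       ys f = sym (+-identityˡ _)
sumOver-++ (x ∷ xs) ys f = trans (cong (_+_ (f x)) (sumOver-++ xs ys f)) (sym (+-assoc (f x) _ _))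

sumOver-map : ∀ (h : X → Y) (xs : List X) (f : Y → ℤ) → sumOver (map h xs) f ≡ sumOver xs (f ∘ h)
sumOver-map h []       f = refl
sumOver-map h (x ∷ xs) f = cong (_+_ (f (h x))) (sumOver-map h xs f)

sumOver-filter : ∀ {R : X → Set} (R? : Decidable R) xs (f : X → ℤ) →
                 sumOver (filter R? xs) f ≡ sumOver xs (λ x → 𝟙 (R? x) * f x)
sumOver-filter R? []       f = refl
sumOver-filter R? (x ∷ xs) f with R? x
... | yes _ = cong₂ _+_ (sym (*-identityˡ (f x))) (sumOver-filter R? xs f)
... | no  _ = trans (sumOver-filter R? xs f) (sym (+-identityˡ _))

sumOver-tabulate : ∀ {n} (h : Fin n → X) (f : X → ℤ) → sumOver (tabulate h) f ≡ sum (f ∘ h)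
sumOver-tabulate {n = zero}  h f = refl
sumOver-tabulate {n = suc n} h f = cong (_+_ (f (h zero))) (sumOver-tabulate (h ∘ suc) f)

sumOver-allFin : ∀ n (f : Fin n → ℤ) → sumOver (allFin n) f ≡ sum f
sumOver-allFin n = sumOver-tabulate id

sumOver-length : (xs : List X) → + length xs ≡ sumOver xs (λ _ → 1ℤ)
sumOver-length []       = refl
sumOver-length (x ∷ xs) = cong (_+_ 1ℤ) (sumOver-length xs)

sumOver-cartesianProductWith : ∀ {Z : Set} (h : X → Y → Z) xs ys (f : Z → ℤ) →
  sumOver (cartesianProductWith h xs ys) f ≡ sumOver xs (λ x → sumOver ys (λ y → f (h x y)))
sumOver-cartesianProductWith h []       ys f = refl
sumOver-cartesianProductWith h (x ∷ xs) ys f = trans (sumOver-++ (map (h x) ys) _ f)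
  (cong₂ _+_ (sumOver-map (h x) ys f) (sumOver-cartesianProductWith h xs ys f))

sumOver-listsUpTo : ∀ N n (f : List (Fin n) → ℤ) →
  sumOver (listsUpTo (suc N) (allFin n)) f ≡
  f [] + sum (λ e → sumOver (listsUpTo N (allFin n)) (λ es → f (e ∷ es)))
sumOver-listsUpTo N n f = cong (_+_ (f [])) (trans
  (sumOver-cartesianProductWith _∷_ (allFin n) (listsUpTo N (allFin n)) f) (sumOver-allFin n _))

sumOver-listsUpTo-[] : ∀ N n (f : List (Fin n) → ℤ) → (∀ e es → f (e ∷ es) ≡ 0ℤ) →
                       sumOver (listsUpTo N (allFin n)) f ≡ f []
sumOver-listsUpTo-[] zero    n f eq = +-identityʳ (f [])
sumOver-listsUpTo-[] (suc N) n f eq = trans (sumOver-listsUpTo N n f) (trans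
  (cong (_+_ (f [])) (sum-zero λ e → sumOver-zero (listsUpTo N (allFin n)) (eq e))) (+-identityʳ (f [])))

-- The only lists that the larger bound adds have length `suc N`.
sumOver-listsUpTo-suc : ∀ N n (f : List (Fin n) → ℤ) → (∀ es → N ℕ.< length es → f es ≡ 0ℤ) →
  sumOver (listsUpTo (suc N) (allFin n)) f ≡ sumOver (listsUpTo N (allFin n)) f
sumOver-listsUpTo-suc zero    n f eq = trans
  (sumOver-listsUpTo-[] 1 n f (λ e es → eq (e ∷ es) (ℕ.s≤s ℕ.z≤n))) (sym (+-identityʳ (f [])))
sumOver-listsUpTo-suc (suc N) n f eq = trans (sumOver-listsUpTo (suc N) n f) (trans
  (cong (_+_ (f [])) (sum-cong-≗ λ e → sumOver-listsUpTo-suc N n (λ es → f (e ∷ es)) λ es l → eq (e ∷ es) (ℕ.s≤s l)))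
  (sym (sumOver-listsUpTo N n f)))

-- Duplicate-free lists in finite sets of vertices

x∉p-x : ∀ (x : Fin n) {p : Subset n} → x ∉ p ⊝ x
x∉p-x zero    {_ ∷ˢ p} ()
x∉p-x (suc x) {_ ∷ˢ p} (thereˢ x∈p-x) = x∉p-x x x∈p-x

x∈p-y⇒x∈p : ∀ {x} y {p : Subset n} → x ∈ p ⊝ y → x ∈ p
x∈p-y⇒x∈p y {p} = p─q⊆p p ⁅ y ⁆

x∈p-y⇒x≢y : ∀ {x} y {p : Subset n} → x ∈ p ⊝ y → x ≢ y
x∈p-y⇒x≢y y x∈p-y refl = x∉p-x y x∈p-y

infixl 5 _∖_

_∖_ : Subset n → List (Fin n) → Subset n
S ∖ []       = S
S ∖ (x ∷ xs) = (S ⊝ x) ∖ xs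

-- Removing each entry before the next one is tested makes this say at once that the list lies in S
-- and has no repetitions. The recursion matches the expansion of rows below, where every vertex
-- visited leaves S.
Within : Subset n → List (Fin n) → Set
Within S []       = ⊤
Within S (x ∷ xs) = x ∈ S × Within (S ⊝ x) xs

within? : ∀ (S : Subset n) xs → Dec (Within S xs)
within? S []       = yes tt
within? S (x ∷ xs) = (x ∈? S) ×-dec within? (S ⊝ x) xs

x∈S∖xs⁺ : ∀ xs {S : Subset n} {y} → y ∈ S → y ∉ˡ xs → y ∈ S ∖ xs
x∈S∖xs⁺ []       y∈S y∉xs = y∈S
x∈S∖xs⁺ (x ∷ xs) y∈S y∉xs = x∈S∖xs⁺ xs (x∈p∧x≢y⇒x∈p-y y∈S (y∉xs ∘ here)) (y∉xs ∘ there)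

x∈S∖xs⇒x∈S : ∀ xs {S : Subset n} {y} → y ∈ S ∖ xs → y ∈ S
x∈S∖xs⇒x∈S []       y∈ = y∈
x∈S∖xs⇒x∈S (x ∷ xs) y∈ = x∈p-y⇒x∈p x (x∈S∖xs⇒x∈S xs y∈)

x∈S∖xs⇒x∉xs : ∀ xs {S : Subset n} {y} → y ∈ S ∖ xs → y ∉ˡ xs
x∈S∖xs⇒x∉xs (x ∷ xs) y∈ (here refl)  = x∉p-x x (x∈S∖xs⇒x∈S xs y∈)
x∈S∖xs⇒x∉xs (x ∷ xs) y∈ (there y∈xs) = x∈S∖xs⇒x∉xs xs y∈ y∈xs

∖-comm : ∀ xs ys (S : Subset n) → S ∖ xs ∖ ys ≡ S ∖ ys ∖ xs
∖-comm xs ys S = ⊆-antisym (half xs ys) (half ys xs)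
  where
  half : ∀ xs ys → S ∖ xs ∖ ys ⊆ S ∖ ys ∖ xs
  half xs ys x∈ = x∈S∖xs⁺ xs
    (x∈S∖xs⁺ ys (x∈S∖xs⇒x∈S xs (x∈S∖xs⇒x∈S ys x∈)) (x∈S∖xs⇒x∉xs ys x∈))
    (x∈S∖xs⇒x∉xs xs (x∈S∖xs⇒x∈S ys x∈))

within⁺ : ∀ {S : Subset n} {xs} → Unique xs → (∀ {x} → x ∈ˡ xs → x ∈ S) → Within S xs
within⁺ []         xs⊆S = tt
within⁺ (x∉xs ∷ u) xs⊆S = xs⊆S (here refl) ,
  within⁺ u λ y∈xs → x∈p∧x≢y⇒x∈p-y (xs⊆S (there y∈xs)) (All.lookup x∉xs y∈xs ∘ sym)

within⇒∈ : ∀ xs {S : Subset n} → Within S xs → ∀ {x} → x ∈ˡ xs → x ∈ S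
within⇒∈ (x ∷ xs) (x∈S , w) (here refl)  = x∈S
within⇒∈ (x ∷ xs) (x∈S , w) (there y∈xs) = x∈p-y⇒x∈p x (within⇒∈ xs w y∈xs)

within⇒unique : ∀ xs {S : Subset n} → Within S xs → Unique xs
within⇒unique []       w         = []
within⇒unique (x ∷ xs) (x∈S , w) =
  All.tabulate (λ y∈xs → x∈p-y⇒x≢y x (within⇒∈ xs w y∈xs) ∘ sym) ∷ within⇒unique xs w

within-++⁺ : ∀ xs {ys} {S : Subset n} → Within S xs → Within (S ∖ xs) ys → Within S (xs ++ ys)
within-++⁺ []       w         w′ = w′
within-++⁺ (x ∷ xs) (x∈S , w) w′ = x∈S , within-++⁺ xs w w′

within-++⁻ : ∀ xs {ys} {S : Subset n} → Within S (xs ++ ys) → Within S xs × Within (S ∖ xs) ys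
within-++⁻ []       w         = tt , w
within-++⁻ (x ∷ xs) (x∈S , w) = let w₁ , w₂ = within-++⁻ xs w in (x∈S , w₁) , w₂

-- The condition is symmetric in disguise: xs and ys are free of repetitions, disjoint from each
-- other and contained in S.
within-exchange : ∀ xs ys {S : Subset n} → Within S xs × Within (S ∖ xs) ys → Within S ys × Within (S ∖ ys) xs
within-exchange xs ys (wx , wy) =
  within⁺ (within⇒unique ys wy) (x∈S∖xs⇒x∈S xs ∘ within⇒∈ ys wy) ,
  within⁺ (within⇒unique xs wx) λ x∈xs → x∈S∖xs⁺ ys (within⇒∈ xs wx x∈xs)
    λ x∈ys → x∈S∖xs⇒x∉xs xs (within⇒∈ ys wy x∈ys) x∈xs

within⇒length : ∀ xs {S : Subset n} → Within S xs → length xs ℕ.≤ ∣ S ∣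
within⇒length []       w         = ℕ.z≤n
within⇒length (x ∷ xs) (x∈S , w) = ℕₚ.≤-trans (ℕ.s≤s (within⇒length xs w)) (x∈p⇒∣p-x∣<∣p∣ x∈S)

-- Sums over cycle systems

module CycleSums (G : Digraph) (ω : Digraph.Edge G → ℤ) where
  open Digraph G
  open DecMembership (_≟_ {#V}) using () renaming (_∈?_ to _∈ˡ?_)

  vs : List Edge → List Vertex
  vs = map src

  weight : List Edge → ℤ
  weight = List.foldr (λ e x → ω e * x) 1ℤ

  -- The sum of ∏ (- weight c) over the sets of pairwise disjoint members of
  -- the list that visit only vertices of S.
  cycleSum : Subset #V → List (List Edge) → ℤ
  cycleSum S []      = 1ℤ
  cycleSum S (c ∷ L) = cycleSum S L - 𝟙 (within? S (vs c)) * (weight c * cycleSum (S ∖ vs c) L)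

  cycleSum-skip : ∀ {S c} L → ¬ Within S (vs c) → cycleSum S (c ∷ L) ≡ cycleSum S L
  cycleSum-skip {S} {c} L ¬w = trans
    (cong (λ x → cycleSum S L - x * (weight c * cycleSum (S ∖ vs c) L)) (𝟙-no (within? S (vs c)) ¬w))
    (lemma (cycleSum S L) (weight c * cycleSum (S ∖ vs c) L))
    where
    lemma : ∀ x y → x - 0ℤ * y ≡ x
    lemma = solve-∀

  through : Vertex → Subset #V → List Edge → ℤ
  through s S c = 𝟙 ((s ∈ˡ? vs c) ×-dec within? S (vs c)) * weight c

  -- Disjoint members of L visit s at most once, so a set of them either avoids s or has exactly one
  -- member c through s, and its other members avoid the vertices of c. The whole list L can be kept
  -- for these others, since nothing that visits s fits any more.
  cycleSum-through : ∀ s S L → cycleSum S L ≡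
    cycleSum (S ⊝ s) L - sumOver L (λ c → through s S c * cycleSum (S ∖ vs c) L)
  cycleSum-through s S []      = refl
  cycleSum-through s S (c ∷ L) with s ∈ˡ? vs c
  -- Neither S without s nor S without the vertices of a list through s admits c, so c may be put
  -- back into every list on the right.
  ... | yes s∈c = begin
    F S L - α * (w * F (S ∖ vs c) L)
      ≡⟨ cong (_- α * (w * F (S ∖ vs c) L)) (cycleSum-through s S L) ⟩
    F (S ⊝ s) L - Z - α * (w * F (S ∖ vs c) L)
      ≡⟨ arrange (F (S ⊝ s) L) Z α w (F (S ∖ vs c) L) ⟩
    F (S ⊝ s) L - (α * w * F (S ∖ vs c) L + Z)
      ≡⟨ cong₂ (λ x y → x - (α * w * y + Z)) (skip {S ⊝ s} (x∉p-x s)) (skip {S ∖ vs c} (λ s∈ → x∈S∖xs⇒x∉xs (vs c) s∈ s∈c)) ⟨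
    F (S ⊝ s) (c ∷ L) - (α * w * F (S ∖ vs c) (c ∷ L) + Z)
      ≡⟨ cong (λ x → F (S ⊝ s) (c ∷ L) - (α * w * F (S ∖ vs c) (c ∷ L) + x)) (sumOver-cong L tail-term) ⟩
    F (S ⊝ s) (c ∷ L) - (α * w * F (S ∖ vs c) (c ∷ L) + sumOver L (λ d → through s S d * F (S ∖ vs d) (c ∷ L))) ∎
    where
    open ≡-Reasoning
    F = cycleSum
    α = 𝟙 (within? S (vs c))
    w = weight c
    Z = sumOver L (λ d → through s S d * F (S ∖ vs d) L)
    skip : ∀ {T} → s ∉ T → F T (c ∷ L) ≡ F T L
    skip s∉T = cycleSum-skip {c = c} L λ wc → s∉T (within⇒∈ (vs c) wc s∈c)
    arrange : ∀ x z a w y → x - z - a * (w * y) ≡ x - (a * w * y + z)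
    arrange = solve-∀
    tail-term : ∀ d → through s S d * F (S ∖ vs d) L ≡ through s S d * F (S ∖ vs d) (c ∷ L)
    tail-term d = begin
      χ * weight d * F (S ∖ vs d) L
        ≡⟨ *-assoc χ (weight d) (F (S ∖ vs d) L) ⟩
      χ * (weight d * F (S ∖ vs d) L)
        ≡⟨ 𝟙-guard ((s ∈ˡ? vs d) ×-dec within? S (vs d)) (λ (s∈d , _) → cong (weight d *_)
             (sym (skip {S ∖ vs d} λ s∈ → x∈S∖xs⇒x∉xs (vs d) s∈ s∈d))) ⟩
      χ * (weight d * F (S ∖ vs d) (c ∷ L))
        ≡⟨ *-assoc χ (weight d) (F (S ∖ vs d) (c ∷ L)) ⟨
      χ * weight d * F (S ∖ vs d) (c ∷ L) ∎
      where χ = 𝟙 ((s ∈ˡ? vs d) ×-dec within? S (vs d))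
  -- The induction hypothesis is used for S and for S without the vertices of c. The two resulting
  -- sums combine because c and a list d through s can be removed in either order. The summand with
  -- the factor 0ℤ is the term of c itself, which misses s.
  ... | no s∉c = begin
    F S L - α * (w * F (S ∖ vs c) L)
      ≡⟨ cong₂ (λ x y → x - α * (w * y)) (cycleSum-through s S L) (cycleSum-through s (S ∖ vs c) L) ⟩
    F (S ⊝ s) L - Z - α * (w * (F (S ∖ vs c ⊝ s) L - Zc))
      ≡⟨ arrange (F (S ⊝ s) L) Z α w (F (S ∖ vs c ⊝ s) L) Zc ⟩
    F (S ⊝ s) L - α * (w * F (S ∖ vs c ⊝ s) L) - (0ℤ * w * F (S ∖ vs c) (c ∷ L) + (1ℤ * Z + - (α * w) * Zc))
      ≡⟨ cong₂ (λ x y → x - (0ℤ * w * F (S ∖ vs c) (c ∷ L) + y)) smaller tails ⟩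
    F (S ⊝ s) (c ∷ L) - (0ℤ * w * F (S ∖ vs c) (c ∷ L) + sumOver L (λ d → through s S d * F (S ∖ vs d) (c ∷ L))) ∎
    where
    open ≡-Reasoning
    F = cycleSum
    α = 𝟙 (within? S (vs c))
    w = weight c
    Z  = sumOver L (λ d → through s S d * F (S ∖ vs d) L)
    Zc = sumOver L (λ d → through s (S ∖ vs c) d * F (S ∖ vs c ∖ vs d) L)
    arrange : ∀ x z a w y z′ → x - z - a * (w * (y - z′)) ≡
              x - a * (w * y) - (0ℤ * w * F (S ∖ vs c) (c ∷ L) + (1ℤ * z + - (a * w) * z′))
    arrange x z a w y z′ = lemma x z a w y z′ (F (S ∖ vs c) (c ∷ L))
      where
      lemma : ∀ x z a w y z′ f → x - z - a * (w * (y - z′)) ≡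
              x - a * (w * y) - (0ℤ * w * f + (1ℤ * z + - (a * w) * z′))
      lemma = solve-∀
    smaller : F (S ⊝ s) L - α * (w * F (S ∖ vs c ⊝ s) L) ≡ F (S ⊝ s) (c ∷ L)
    smaller = cong₂ (λ a T → F (S ⊝ s) L - a * (w * F T L))
      (𝟙-cong {p = within? S (vs c)} {q = within? (S ⊝ s) (vs c)}
        (λ wc → within⁺ (within⇒unique (vs c) wc) λ x∈c →
          x∈p∧x≢y⇒x∈p-y (within⇒∈ (vs c) wc x∈c) λ { refl → s∉c x∈c })
        (λ wc → within⁺ (within⇒unique (vs c) wc) (x∈p-y⇒x∈p s ∘ within⇒∈ (vs c) wc)))
      (∖-comm (vs c) (s ∷ []) S)
    term : ∀ d → 1ℤ * (through s S d * F (S ∖ vs d) L) +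
                 - (α * w) * (through s (S ∖ vs c) d * F (S ∖ vs c ∖ vs d) L) ≡
                 through s S d * F (S ∖ vs d) (c ∷ L)
    term d = begin
      1ℤ * (τ * wd * Fd) + - (α * w) * (𝟙 (s∈d ×-dec within? (S ∖ vs c) (vs d)) * wd * Fcd)
        ≡⟨ cong₂ (λ x y → 1ℤ * (x * wd * Fd) + - (α * w) * (y * wd * Fcd))
             (𝟙-× s∈d (within? S (vs d))) (𝟙-× s∈d (within? (S ∖ vs c) (vs d))) ⟩
      1ℤ * (σ * δ * wd * Fd) + - (α * w) * (σ * 𝟙 (within? (S ∖ vs c) (vs d)) * wd * Fcd)
        ≡⟨ arrange₁ σ δ wd Fd α w (𝟙 (within? (S ∖ vs c) (vs d))) Fcd ⟩
      σ * δ * wd * Fd - (α * 𝟙 (within? (S ∖ vs c) (vs d))) * (σ * w * wd * Fcd)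
        ≡⟨ cong₂ (λ x T → σ * δ * wd * Fd - x * (σ * w * wd * F T L)) exchange (∖-comm (vs c) (vs d) S) ⟩
      σ * δ * wd * Fd - (δ * 𝟙 (within? (S ∖ vs d) (vs c))) * (σ * w * wd * F (S ∖ vs d ∖ vs c) L)
        ≡⟨ arrange₂ σ δ wd Fd (𝟙 (within? (S ∖ vs d) (vs c))) w (F (S ∖ vs d ∖ vs c) L) ⟩
      σ * δ * wd * F (S ∖ vs d) (c ∷ L)
        ≡⟨ cong (λ x → x * wd * F (S ∖ vs d) (c ∷ L)) (𝟙-× s∈d (within? S (vs d))) ⟨
      τ * wd * F (S ∖ vs d) (c ∷ L) ∎
      where
      s∈d = s ∈ˡ? vs d
      σ   = 𝟙 s∈d
      δ   = 𝟙 (within? S (vs d))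
      τ   = 𝟙 (s∈d ×-dec within? S (vs d))
      wd  = weight d
      Fd  = F (S ∖ vs d) L
      Fcd = F (S ∖ vs c ∖ vs d) L
      arrange₁ : ∀ σ δ wd f a w b f′ → 1ℤ * (σ * δ * wd * f) + - (a * w) * (σ * b * wd * f′) ≡
                 σ * δ * wd * f - (a * b) * (σ * w * wd * f′)
      arrange₁ = solve-∀
      arrange₂ : ∀ σ δ wd f b w f′ → σ * δ * wd * f - (δ * b) * (σ * w * wd * f′) ≡
                 σ * δ * wd * (f - b * (w * f′))
      arrange₂ = solve-∀
      exchange : α * 𝟙 (within? (S ∖ vs c) (vs d)) ≡ δ * 𝟙 (within? (S ∖ vs d) (vs c))
      exchange = trans (sym (𝟙-× (within? S (vs c)) (within? (S ∖ vs c) (vs d)))) (trans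
        (𝟙-cong {p = within? S (vs c) ×-dec within? (S ∖ vs c) (vs d)}
                {q = within? S (vs d) ×-dec within? (S ∖ vs d) (vs c)}
          (within-exchange (vs c) (vs d)) (within-exchange (vs d) (vs c)))
        (𝟙-× (within? S (vs d)) (within? (S ∖ vs d) (vs c))))
    tails : 1ℤ * Z + - (α * w) * Zc ≡ sumOver L (λ d → through s S d * F (S ∖ vs d) (c ∷ L))
    tails = trans (sym (sumOver-linear 1ℤ (- (α * w)) L (λ d → through s S d * F (S ∖ vs d) L)
      (λ d → through s (S ∖ vs c) d * F (S ∖ vs c ∖ vs d) L))) (sumOver-cong L term)

-- Expansion of a form along the edges

module _ (G : Digraph) (ω : Digraph.Edge G → ℤ) where
  open Digraph G
  open CycleSums G ω
  open DecMembership (_≟_ {#V}) using () renaming (_∈?_ to _∈ˡ?_)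

  module _ {C : Set} (Φ : AltForm #V C) (b : Vertex → C → ℤ) where

    private
      coeff : Vertex → Edge → ℤ
      coeff u e = 𝟙 (src e ≟ u) * ω e

    stepRow : Vertex → C → ℤ
    stepRow u c = b u c - sum (λ e → coeff u e * b (tgt e) c)

    -- This interpolates between `b`, for the empty set, and `stepRow`, for the full one; expanding
    -- the row of a vertex removes the vertex from S.
    stepRows : Subset #V → Vertex → C → ℤ
    stepRows S u = if does (u ∈? S) then stepRow u else b u

    D : Subset #V → ℤ
    D S = ⟦ Φ ⟧ (stepRows S)

    -- The state of the expansion after a path from s to u has been followed: the vertices passed
    -- have left S, and row s holds the vector of the vertex reached.
    Dᵣ : Subset #V → Vertex → Vertex → ℤ
    Dᵣ S s u = ⟦ Φ ⟧ (stepRows S [ s ≔ b u ])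

    stepRows-∈ : ∀ {S u} → u ∈ S → ∀ c → stepRows S u c ≡ stepRow u c
    stepRows-∈ {S} {u} u∈S c with u ∈? S
    ... | yes _  = refl
    ... | no u∉S = contradiction u∈S u∉S

    stepRows-∉ : ∀ {S u} → u ∉ S → ∀ c → stepRows S u c ≡ b u c
    stepRows-∉ {S} {u} u∉S c with u ∈? S
    ... | yes u∈S = contradiction u∈S u∉S
    ... | no _    = refl

    stepRows-minus : ∀ s S {u} → u ≢ s → ∀ c → stepRows S u c ≡ stepRows (S ⊝ s) u c
    stepRows-minus s S {u} u≢s c with u ∈? S
    ... | yes u∈S = sym (stepRows-∈ (x∈p∧x≢y⇒x∈p-y u∈S u≢s) c)
    ... | no  u∉S = sym (stepRows-∉ {S ⊝ s} (u∉S ∘ x∈p-y⇒x∈p s) c)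

    expand-stepRow : ∀ i {M} → (∀ c → M i c ≡ stepRow i c) →
                     ⟦ Φ ⟧ M ≡ ⟦ Φ ⟧ (M [ i ≔ b i ]) - sum (λ e → coeff i e * ⟦ Φ ⟧ (M [ i ≔ b (tgt e) ]))
    expand-stepRow i {M} eq = begin
      ⟦ Φ ⟧ M
        ≡⟨ linear-≔ Φ i 1ℤ -1ℤ {M} {b i} {Σb} (λ c → trans (eq c) (signs (b i c) (Σb c))) ⟩
      1ℤ * ⟦ Φ ⟧ (M [ i ≔ b i ]) + -1ℤ * ⟦ Φ ⟧ (M [ i ≔ Σb ])
        ≡⟨ signs (⟦ Φ ⟧ (M [ i ≔ b i ])) (⟦ Φ ⟧ (M [ i ≔ Σb ])) ⟨
      ⟦ Φ ⟧ (M [ i ≔ b i ]) - ⟦ Φ ⟧ (M [ i ≔ Σb ])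
        ≡⟨ cong (_-_ (⟦ Φ ⟧ (M [ i ≔ b i ]))) (trans
             (sum-row Φ i (coeff i) (b ∘ tgt) (≔-updates M i))
             (sum-cong-≗ λ e → cong (coeff i e *_) (cong-rows Φ (overwrite e)))) ⟩
      ⟦ Φ ⟧ (M [ i ≔ b i ]) - sum (λ e → coeff i e * ⟦ Φ ⟧ (M [ i ≔ b (tgt e) ])) ∎
      where
      open ≡-Reasoning
      Σb = λ c → sum (λ e → coeff i e * b (tgt e) c)
      signs : ∀ x y → x - y ≡ 1ℤ * x + -1ℤ * y
      signs = solve-∀
      overwrite : ∀ e → M [ i ≔ Σb ] [ i ≔ b (tgt e) ] ≋ M [ i ≔ b (tgt e) ]
      overwrite e = ≔-unique (λ r≢i c → trans (≔-minimal (M [ i ≔ Σb ]) i r≢i c) (≔-minimal M i r≢i c))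
        (≔-updates (M [ i ≔ Σb ]) i)

    Dᵣ-diag : ∀ {S s} → s ∉ S → Dᵣ S s s ≡ D S
    Dᵣ-diag {S} {s} s∉S = sym (cong-rows Φ (≔-unique (λ _ _ → refl) (stepRows-∉ s∉S)))

    D-expand : ∀ {S s} → s ∈ S → D S ≡ D (S ⊝ s) - sum (λ e → coeff s e * Dᵣ (S ⊝ s) s (tgt e))
    D-expand {S} {s} s∈S = trans (expand-stepRow s {stepRows S} (stepRows-∈ s∈S))
      (cong₂ _-_ (trans (replaced s) (Dᵣ-diag (x∉p-x s))) (sum-cong-≗ λ e → cong (coeff s e *_) (replaced (tgt e))))
      where
      replaced : ∀ u → ⟦ Φ ⟧ (stepRows S [ s ≔ b u ]) ≡ Dᵣ (S ⊝ s) s u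
      replaced u = cong-rows Φ (≔-unique
        (λ r≢s c → trans (≔-minimal (stepRows S) s r≢s c) (stepRows-minus s S r≢s c)) (≔-updates (stepRows S) s))

    -- Row u is already `b u`, hence equal to row s unless u is s itself. A path that leaves S
    -- survives only if it has returned to its start.
    Dᵣ-outside : ∀ {S s u} → s ∉ S → u ∉ S → Dᵣ S s u ≡ 𝟙 (u ≟ s) * D S
    Dᵣ-outside {S} {s} {u} s∉S u∉S with u ≟ s
    ... | yes refl = trans (Dᵣ-diag s∉S) (sym (*-identityˡ (D S)))
    ... | no  u≢s  = alternating Φ u≢s λ c → trans (≔-minimal (stepRows S) s u≢s c)
      (trans (stepRows-∉ u∉S c) (sym (≔-updates (stepRows S) s c)))

    -- Expanding row u of a matrix whose row s is b u leaves, up to an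
    -- exchange of these two rows, the matrices for the targets of the edges at u.
    Dᵣ-inside : ∀ {S s u} → s ∉ S → u ∈ S → Dᵣ S s u ≡ sum (λ e → coeff u e * Dᵣ (S ⊝ u) s (tgt e))
    Dᵣ-inside {S} {s} {u} s∉S u∈S = begin
      ⟦ Φ ⟧ M
        ≡⟨ expand-stepRow u {M} (λ c → trans (≔-minimal (stepRows S) s u≢s c) (stepRows-∈ u∈S c)) ⟩
      ⟦ Φ ⟧ (M [ u ≔ b u ]) - sum (λ e → coeff u e * ⟦ Φ ⟧ (M [ u ≔ b (tgt e) ]))
        ≡⟨ cong₂ _-_ repeated (trans (sum-cong-≗ exchanged) (sum-neg (λ e → coeff u e * Dᵣ (S ⊝ u) s (tgt e)))) ⟩
      -- The minus sign of the row cancels against that of the exchange, so a whole cycle acquires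
      -- just one sign, that of its first edge in `D-expand`.
      0ℤ - - sum (λ e → coeff u e * Dᵣ (S ⊝ u) s (tgt e))
        ≡⟨ lemma (sum (λ e → coeff u e * Dᵣ (S ⊝ u) s (tgt e))) ⟩
      sum (λ e → coeff u e * Dᵣ (S ⊝ u) s (tgt e)) ∎
      where
      open ≡-Reasoning
      lemma : ∀ x → 0ℤ - - x ≡ x
      lemma = solve-∀
      u≢s : u ≢ s
      u≢s refl = s∉S u∈S
      M = stepRows S [ s ≔ b u ]
      Ms : ∀ {x} c → (M [ u ≔ x ]) s c ≡ b u c
      Ms c = trans (≔-minimal M u (u≢s ∘ sym) c) (≔-updates (stepRows S) s c)
      repeated : ⟦ Φ ⟧ (M [ u ≔ b u ]) ≡ 0ℤ
      repeated = alternating Φ u≢s λ c → trans (≔-updates M u c) (sym (Ms c))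
      R : Vertex → Vertex → C → ℤ
      R x = stepRows (S ⊝ u) [ s ≔ b x ]
      exchange : ∀ x → ⟦ Φ ⟧ (M [ u ≔ b x ]) ≡ - Dᵣ (S ⊝ u) s x
      exchange x = antisym Φ u≢s
        (λ r≢u r≢s c → trans (≔-minimal M u r≢u c) (trans (≔-minimal (stepRows S) s r≢s c)
          (trans (stepRows-minus u S r≢u c) (sym (≔-minimal (stepRows (S ⊝ u)) s r≢s c)))))
        (λ c → trans (≔-updates M u c) (sym (≔-updates (stepRows (S ⊝ u)) s c)))
        (λ c → trans (Ms c) (sym (trans (≔-minimal (stepRows (S ⊝ u)) s u≢s c) (stepRows-∉ (x∉p-x u) c))))
      neg-out : ∀ x y → x * - y ≡ - (x * y)
      neg-out = solve-∀
      exchanged : ∀ e → coeff u e * ⟦ Φ ⟧ (M [ u ≔ b (tgt e) ]) ≡ - (coeff u e * Dᵣ (S ⊝ u) s (tgt e))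
      exchanged e = trans (cong (coeff u e *_) (exchange (tgt e))) (neg-out (coeff u e) (Dᵣ (S ⊝ u) s (tgt e)))

    pathTerm : Subset #V → Vertex → Vertex → List Edge → ℤ
    pathTerm S s u es = 𝟙 (isWalk? G u es s ×-dec within? S (vs es)) * (weight es * D (S ∖ vs es))

    pathTerm-∷ : ∀ S s {u} → u ∈ S → ∀ e es →
                 pathTerm S s u (e ∷ es) ≡ coeff u e * pathTerm (S ⊝ u) s (tgt e) es
    pathTerm-∷ S s {u} u∈S e es with src e ≟ u
    ... | no _ = refl
    ... | yes refl = trans
      (cong (_* (ω e * weight es * D (S ⊝ u ∖ vs es)))
        (𝟙-cong {p = isWalk? G (tgt e) es s ×-dec within? S (u ∷ vs es)}
                {q = isWalk? G (tgt e) es s ×-dec within? (S ⊝ u) (vs es)}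
          (λ (walk , _ , w) → walk , w) (λ (walk , w) → walk , u∈S , w)))
      (arrange (𝟙 (isWalk? G (tgt e) es s ×-dec within? (S ⊝ u) (vs es))) (ω e) (weight es) (D (S ⊝ u ∖ vs es)))
      where
      arrange : ∀ i a w d → i * (a * w * d) ≡ 1ℤ * a * (i * (w * d))
      arrange = solve-∀

    -- Each edge of a path from u back to s uses up one vertex of S, so lists of length at most
    -- `∣ S ∣` suffice and the bound drops along with S. If u is in S, `Dᵣ-inside` splits off the
    -- first edge; if not, only the empty list remains, and it closes the cycle exactly when u is s.
    sum-paths : ∀ N S {s} → s ∉ S → ∣ S ∣ ℕ.≤ N → ∀ u →
                sumOver (listsUpTo N (allFin #E)) (pathTerm S s u) ≡ Dᵣ S s u
    sum-paths N S {s} s∉S ∣S∣≤N u with u ∈? S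
    ... | no u∉S = trans (sumOver-listsUpTo-[] N #E (pathTerm S s u) nonempty) (trans
      (cong₂ _*_ (𝟙-cong {p = isWalk? G u [] s ×-dec within? S []} {q = u ≟ s} proj₁ (λ u≡s → u≡s , tt))
        (*-identityˡ (D S)))
      (sym (Dᵣ-outside s∉S u∉S)))
      where
      nonempty : ∀ e es → pathTerm S s u (e ∷ es) ≡ 0ℤ
      nonempty e es = trans (cong (_* (weight (e ∷ es) * D (S ∖ vs (e ∷ es))))
        (𝟙-no (isWalk? G u (e ∷ es) s ×-dec within? S (vs (e ∷ es))) λ { ((refl , _) , (u∈S , _)) → u∉S u∈S }))
        (*-zeroˡ (weight (e ∷ es) * D (S ∖ vs (e ∷ es))))
    sum-paths zero S s∉S ∣S∣≤0 u | yes u∈S = contradiction (ℕₚ.<-≤-trans (x∈p⇒∣p-x∣<∣p∣ u∈S) ∣S∣≤0) λ ()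
    sum-paths (suc N) S {s} s∉S ∣S∣≤1+N u | yes u∈S = begin
      sumOver (listsUpTo (suc N) (allFin #E)) (pathTerm S s u)
        ≡⟨ sumOver-listsUpTo N #E (pathTerm S s u) ⟩
      pathTerm S s u [] + sum (λ e → sumOver (listsUpTo N (allFin #E)) (λ es → pathTerm S s u (e ∷ es)))
        ≡⟨ cong₂ _+_ empty (sum-cong-≗ by-first-edge) ⟩
      0ℤ + sum (λ e → coeff u e * Dᵣ (S ⊝ u) s (tgt e))
        ≡⟨ +-identityˡ _ ⟩
      sum (λ e → coeff u e * Dᵣ (S ⊝ u) s (tgt e))
        ≡⟨ Dᵣ-inside s∉S u∈S ⟨
      Dᵣ S s u ∎
      where
      open ≡-Reasoning
      empty : pathTerm S s u [] ≡ 0ℤ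
      empty = trans (cong (_* (1ℤ * D S)) (𝟙-no (isWalk? G u [] s ×-dec within? S []) λ { (refl , _) → s∉S u∈S }))
        (*-zeroˡ (1ℤ * D S))
      ∣S-u∣≤N : ∣ S ⊝ u ∣ ℕ.≤ N
      ∣S-u∣≤N = ℕ.s≤s⁻¹ (ℕₚ.<-≤-trans (x∈p⇒∣p-x∣<∣p∣ u∈S) ∣S∣≤1+N)
      by-first-edge : ∀ e → sumOver (listsUpTo N (allFin #E)) (λ es → pathTerm S s u (e ∷ es)) ≡
                      coeff u e * Dᵣ (S ⊝ u) s (tgt e)
      by-first-edge e = trans (sumOver-cong (listsUpTo N (allFin #E)) (pathTerm-∷ S s u∈S e)) (trans
        (sumOver-*ˡ (coeff u e) (listsUpTo N (allFin #E)) (pathTerm (S ⊝ u) s (tgt e)))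
        (cong (coeff u e *_) (sum-paths N (S ⊝ u) (s∉S ∘ x∈p-y⇒x∈p u) ∣S-u∣≤N (tgt e))))

    -- If s is the least vertex of S, the cycles through s in S are
    -- represented by the lists that start at s.
    sum-cycles-through : ∀ {S s} → s ∈ S → (∀ {x} → x ∈ S → s ≤ᶠ x) →
      sumOver (cycles G) (λ c → through s S c * D (S ∖ vs c)) ≡ sum (λ e → coeff s e * Dᵣ (S ⊝ s) s (tgt e))
    sum-cycles-through {S} {s} s∈S s-least = trans
      (sumOver-filter (λ es → isCycle? G es ×-dec startsAtLeast? G es) (listsUpTo #V (allFin #E)) summand)
      (bounded #V (∣p∣≤n S))
      where
      open ≡-Reasoning
      summand : List Edge → ℤ
      summand c = through s S c * D (S ∖ vs c)
      cyclic? = λ es → isCycle? G es ×-dec startsAtLeast? G es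
      by-first-edge : ∀ e es → 𝟙 (cyclic? (e ∷ es)) * summand (e ∷ es) ≡ coeff s e * pathTerm (S ⊝ s) s (tgt e) es
      by-first-edge e es = begin
        𝟙 (cyclic? (e ∷ es)) * summand (e ∷ es)
          ≡⟨ arrange (𝟙 (cyclic? (e ∷ es))) (𝟙 through?) (weight (e ∷ es)) (D (S ∖ vs (e ∷ es))) ⟩
        𝟙 (cyclic? (e ∷ es)) * 𝟙 through? * (weight (e ∷ es) * D (S ∖ vs (e ∷ es)))
          ≡⟨ cong (_* (weight (e ∷ es) * D (S ∖ vs (e ∷ es)))) (trans
               (sym (𝟙-× (cyclic? (e ∷ es)) through?))
               (𝟙-cong {p = cyclic? (e ∷ es) ×-dec through?}
                       {q = isWalk? G s (e ∷ es) s ×-dec within? S (vs (e ∷ es))} to from)) ⟩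
        pathTerm S s s (e ∷ es)
          ≡⟨ pathTerm-∷ S s s∈S e es ⟩
        coeff s e * pathTerm (S ⊝ s) s (tgt e) es ∎
        where
        through? = (s ∈ˡ? vs (e ∷ es)) ×-dec within? S (vs (e ∷ es))
        arrange : ∀ i j w d → i * (j * w * d) ≡ i * j * (w * d)
        arrange = solve-∀
        to : (IsCycle G (e ∷ es) × StartsAtLeast G (e ∷ es)) × (s ∈ˡ vs (e ∷ es) × Within S (vs (e ∷ es))) →
             IsWalk G s (e ∷ es) s × Within S (vs (e ∷ es))
        to (((walk , _) , least) , s∈ , w@(src-e∈S , _)) =
          subst (λ x → IsWalk G x (e ∷ es) x) (toℕ-injective (ℕₚ.≤-antisym (least-≤ s∈) (s-least src-e∈S))) walk , w
          where
          least-≤ : s ∈ˡ vs (e ∷ es) → src e ≤ᶠ s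
          least-≤ (here refl) = ℕₚ.≤-refl
          least-≤ (there s∈)  = All.lookup (Allₚ.map⁺ least) s∈
        from : IsWalk G s (e ∷ es) s × Within S (vs (e ∷ es)) →
               (IsCycle G (e ∷ es) × StartsAtLeast G (e ∷ es)) × (s ∈ˡ vs (e ∷ es) × Within S (vs (e ∷ es)))
        from (walk@(refl , _) , w) = ((walk , within⇒unique (vs (e ∷ es)) w) ,
          Allₚ.map⁻ (All.tabulate λ x∈ → s-least (within⇒∈ (vs (e ∷ es)) w (there x∈)))) , here refl , w
      bounded : ∀ N → ∣ S ∣ ℕ.≤ N → sumOver (listsUpTo N (allFin #E)) (λ c → 𝟙 (cyclic? c) * summand c) ≡
                sum (λ e → coeff s e * Dᵣ (S ⊝ s) s (tgt e))
      bounded zero    ∣S∣≤0 = contradiction (ℕₚ.<-≤-trans (x∈p⇒∣p-x∣<∣p∣ s∈S) ∣S∣≤0) λ ()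
      bounded (suc N) ∣S∣≤1+N = begin
        sumOver (listsUpTo (suc N) (allFin #E)) (λ c → 𝟙 (cyclic? c) * summand c)
          ≡⟨ sumOver-listsUpTo N #E (λ c → 𝟙 (cyclic? c) * summand c) ⟩
        0ℤ + sum (λ e → sumOver (listsUpTo N (allFin #E)) (λ es → 𝟙 (cyclic? (e ∷ es)) * summand (e ∷ es)))
          ≡⟨ +-identityˡ _ ⟩
        sum (λ e → sumOver (listsUpTo N (allFin #E)) (λ es → 𝟙 (cyclic? (e ∷ es)) * summand (e ∷ es)))
          ≡⟨ sum-cong-≗ (λ e → trans (sumOver-cong (listsUpTo N (allFin #E)) (by-first-edge e)) (trans
               (sumOver-*ˡ (coeff s e) (listsUpTo N (allFin #E)) (pathTerm (S ⊝ s) s (tgt e)))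
               (cong (coeff s e *_) (sum-paths N (S ⊝ s) (x∉p-x s)
                 (ℕ.s≤s⁻¹ (ℕₚ.<-≤-trans (x∈p⇒∣p-x∣<∣p∣ s∈S) ∣S∣≤1+N)) (tgt e))))) ⟩
        sum (λ e → coeff s e * Dᵣ (S ⊝ s) s (tgt e)) ∎

    -- Every set of vertices admits the empty list, so the members of L have to be nonempty for an
    -- empty S to exclude them.
    cycleSum-empty : ∀ {S} → (∀ {x} → x ∉ S) → ∀ L → All (_≢ []) L → cycleSum S L ≡ 1ℤ
    cycleSum-empty S-empty [] [] = refl
    cycleSum-empty S-empty ([] ∷ L) (c≢[] ∷ _) = contradiction refl c≢[]
    cycleSum-empty S-empty ((e ∷ c) ∷ L) (_ ∷ nonempty) =
      trans (cycleSum-skip {c = e ∷ c} L (S-empty ∘ proj₁)) (cycleSum-empty S-empty L nonempty)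

    cycles-nonempty : All (_≢ []) (cycles G)
    cycles-nonempty = All.tabulate λ c∈ c≡[] →
      subst (IsCycle G) c≡[] (proj₁ (proj₂ (∈-filter⁻ (λ es → isCycle? G es ×-dec startsAtLeast? G es)
        {xs = listsUpTo #V (allFin #E)} c∈)))

    -- `D` and `cycleSum` obey the same recursion at the least vertex s of S. The vertices are
    -- treated in increasing order: S contains none below t, so the vertex numbered t, if it belongs
    -- to S, is the least as `sum-cycles-through` requires. All sets that remain once it is removed
    -- lie beyond t, and k counts the vertices still to come.
    D-cycleSum : ∀ k t → t ℕ.+ k ≡ #V → ∀ S → (∀ {x} → x ∈ S → t ℕ.≤ toℕ x) →
                 D S ≡ cycleSum S (cycles G) * ⟦ Φ ⟧ b
    D-cycleSum zero t t+0≡#V S S≥t = begin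
      D S                                ≡⟨ cong-rows Φ (λ u → stepRows-∉ S-empty) ⟩
      ⟦ Φ ⟧ b                            ≡⟨ *-identityˡ (⟦ Φ ⟧ b) ⟨
      1ℤ * ⟦ Φ ⟧ b                       ≡⟨ cong (_* ⟦ Φ ⟧ b) (cycleSum-empty S-empty (cycles G) cycles-nonempty) ⟨
      cycleSum S (cycles G) * ⟦ Φ ⟧ b    ∎
      where
      open ≡-Reasoning
      S-empty : ∀ {x} → x ∉ S
      S-empty {x} x∈S = ℕₚ.<⇒≱ (toℕ<n x) (subst (ℕ._≤ toℕ x) (trans (sym (ℕₚ.+-identityʳ t)) t+0≡#V) (S≥t x∈S))
    D-cycleSum (suc k) t t+1+k≡#V S S≥t = by-cases (s ∈? S)
      where
      open ≡-Reasoning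
      1+t+k≡#V : suc t ℕ.+ k ≡ #V
      1+t+k≡#V = trans (sym (ℕₚ.+-suc t k)) t+1+k≡#V
      t<#V : t ℕ.< #V
      t<#V = subst (t ℕ.<_) 1+t+k≡#V (ℕ.s≤s (ℕₚ.m≤m+n t k))
      s : Vertex
      s = fromℕ< t<#V
      beyond : ∀ {T} → s ∉ T → (∀ {x} → x ∈ T → x ∈ S) → ∀ {x} → x ∈ T → suc t ℕ.≤ toℕ x
      beyond s∉T T⊆S {x} x∈T = ℕₚ.≤∧≢⇒< (S≥t (T⊆S x∈T)) λ t≡x →
        s∉T (subst (_∈ _) (toℕ-injective (trans (sym t≡x) (sym (toℕ-fromℕ< t<#V)))) x∈T)
      IH : ∀ T → s ∉ T → (∀ {x} → x ∈ T → x ∈ S) → D T ≡ cycleSum T (cycles G) * ⟦ Φ ⟧ b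
      IH T s∉T T⊆S = D-cycleSum k (suc t) 1+t+k≡#V T (beyond s∉T T⊆S)
      F : Subset #V → ℤ
      F T = cycleSum T (cycles G)
      by-cases : Dec (s ∈ S) → D S ≡ F S * ⟦ Φ ⟧ b
      by-cases (no s∉S)  = IH S s∉S id
      by-cases (yes s∈S) = begin
        D S
          ≡⟨ D-expand s∈S ⟩
        D (S ⊝ s) - sum (λ e → coeff s e * Dᵣ (S ⊝ s) s (tgt e))
          ≡⟨ cong (_-_ (D (S ⊝ s))) (sum-cycles-through s∈S λ {x} x∈S → subst (ℕ._≤ toℕ x) (sym (toℕ-fromℕ< t<#V)) (S≥t x∈S)) ⟨
        D (S ⊝ s) - sumOver (cycles G) (λ c → through s S c * D (S ∖ vs c))
          ≡⟨ cong₂ _-_ (IH (S ⊝ s) (x∉p-x s) (x∈p-y⇒x∈p s)) (sumOver-cong (cycles G) term) ⟩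
        F (S ⊝ s) * ⟦ Φ ⟧ b - sumOver (cycles G) (λ c → through s S c * F (S ∖ vs c) * ⟦ Φ ⟧ b)
          ≡⟨ cong (_-_ (F (S ⊝ s) * ⟦ Φ ⟧ b)) (sumOver-*ʳ (⟦ Φ ⟧ b) (cycles G) (λ c → through s S c * F (S ∖ vs c))) ⟩
        F (S ⊝ s) * ⟦ Φ ⟧ b - Z * ⟦ Φ ⟧ b
          ≡⟨ factor (F (S ⊝ s)) Z (⟦ Φ ⟧ b) ⟩
        (F (S ⊝ s) - Z) * ⟦ Φ ⟧ b
          ≡⟨ cong (_* ⟦ Φ ⟧ b) (cycleSum-through s S (cycles G)) ⟨
        F S * ⟦ Φ ⟧ b ∎
        where
        Z = sumOver (cycles G) (λ c → through s S c * F (S ∖ vs c))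
        factor : ∀ x y z → x * z - y * z ≡ (x - y) * z
        factor = solve-∀
        term : ∀ c → through s S c * D (S ∖ vs c) ≡ through s S c * F (S ∖ vs c) * ⟦ Φ ⟧ b
        term c = begin
          χ * weight c * D (S ∖ vs c)
            ≡⟨ *-assoc χ (weight c) (D (S ∖ vs c)) ⟩
          χ * (weight c * D (S ∖ vs c))
            -- The induction hypothesis applies only if s has been removed together with c; the
            -- indicator restricts the claim to lists through s, where this is so.
            ≡⟨ 𝟙-guard ((s ∈ˡ? vs c) ×-dec within? S (vs c)) (λ (s∈c , _) → cong (weight c *_)
                 (IH (S ∖ vs c) (λ s∈ → x∈S∖xs⇒x∉xs (vs c) s∈ s∈c) (x∈S∖xs⇒x∈S (vs c)))) ⟩
          χ * (weight c * (F (S ∖ vs c) * ⟦ Φ ⟧ b))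
            ≡⟨ reassoc χ (weight c) (F (S ∖ vs c)) (⟦ Φ ⟧ b) ⟩
          χ * weight c * F (S ∖ vs c) * ⟦ Φ ⟧ b ∎
          where
          χ = 𝟙 ((s ∈ˡ? vs c) ×-dec within? S (vs c))
          reassoc : ∀ x w f p → x * (w * (f * p)) ≡ x * w * f * p
          reassoc = solve-∀

    form-stepRow : ⟦ Φ ⟧ stepRow ≡ cycleSum full (cycles G) * ⟦ Φ ⟧ b
    form-stepRow = trans (cong-rows Φ λ u c → sym (stepRows-∈ {full} ∈⊤ c))
      (D-cycleSum #V zero refl full λ _ → ℕ.z≤n)

-- Cycle systems as sublists of the list of cycles

∈-sublists : ∀ {x : X} xs {ys} → ys ∈ˡ sublists xs → x ∈ˡ ys → x ∈ˡ xs
∈-sublists []       (here refl) ()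
∈-sublists (y ∷ xs) ys∈ x∈ys with ∈-++⁻ (map (y ∷_) (sublists xs)) ys∈
... | inj₂ ys∈′ = there (∈-sublists xs ys∈′ x∈ys)
... | inj₁ ys∈′ with ∈-map⁻ (y ∷_) ys∈′
...   | zs , zs∈ , refl with x∈ys
...     | here refl  = here refl
...     | there x∈zs = there (∈-sublists xs zs∈ x∈zs)

module _ (G : Digraph) (ω : Digraph.Edge G → ℤ) where
  open Digraph G
  open CycleSums G ω

  private
    vertices : List (List Edge) → List Vertex
    vertices K = concat (map vs K)

  systemWeight : List (List Edge) → ℤ
  systemWeight = List.foldr (λ c x → - weight c * x) 1ℤ

  -- Fitting the concatenated vertex lists of K into S is a condition that splits at the first
  -- member of K in the same way as the recursion of `cycleSum`.
  cycleSum-sublists : ∀ S L →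
    sumOver (sublists L) (λ K → 𝟙 (within? S (vertices K)) * systemWeight K) ≡ cycleSum S L
  cycleSum-sublists S []      = refl
  cycleSum-sublists S (c ∷ L) = begin
    sumOver (map (c ∷_) (sublists L) ++ sublists L) (f S)
      ≡⟨ sumOver-++ (map (c ∷_) (sublists L)) (sublists L) (f S) ⟩
    sumOver (map (c ∷_) (sublists L)) (f S) + sumOver (sublists L) (f S)
      ≡⟨ cong₂ _+_ (sumOver-map (c ∷_) (sublists L) (f S)) (cycleSum-sublists S L) ⟩
    sumOver (sublists L) (f S ∘ (c ∷_)) + cycleSum S L
      ≡⟨ cong (_+ cycleSum S L) (trans (sumOver-cong (sublists L) term) (trans
           (sumOver-*ˡ (- (α * weight c)) (sublists L) (f (S ∖ vs c)))
           (cong (- (α * weight c) *_) (cycleSum-sublists (S ∖ vs c) L)))) ⟩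
    - (α * weight c) * cycleSum (S ∖ vs c) L + cycleSum S L
      ≡⟨ arrange α (weight c) (cycleSum (S ∖ vs c) L) (cycleSum S L) ⟩
    cycleSum S (c ∷ L) ∎
    where
    open ≡-Reasoning
    f : Subset #V → List (List Edge) → ℤ
    f S K = 𝟙 (within? S (vertices K)) * systemWeight K
    α = 𝟙 (within? S (vs c))
    arrange : ∀ a w y x → - (a * w) * y + x ≡ x - a * (w * y)
    arrange = solve-∀
    arrange′ : ∀ a b w x → a * b * (- w * x) ≡ - (a * w) * (b * x)
    arrange′ = solve-∀
    term : ∀ K → f S (c ∷ K) ≡ - (α * weight c) * f (S ∖ vs c) K
    term K = trans
      (cong (_* (- weight c * systemWeight K)) (trans
        (𝟙-cong {p = within? S (vertices (c ∷ K))}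
                {q = within? S (vs c) ×-dec within? (S ∖ vs c) (vertices K)}
          (within-++⁻ (vs c)) (λ (w , w′) → within-++⁺ (vs c) w w′))
        (𝟙-× (within? S (vs c)) (within? (S ∖ vs c) (vertices K)))))
      (arrange′ α (𝟙 (within? (S ∖ vs c) (vertices K))) (weight c) (systemWeight K))

  disjoint⇒within : ∀ {K} → (∀ {c} → c ∈ˡ K → IsCycle G c) → AllPairs (VertexDisjoint G) K →
                    Within full (vertices K)
  disjoint⇒within cyclic disjoint = within⁺ (concat⁺
    (Allₚ.map⁺ (All.tabulate (unique _ ∘ cyclic))) (allPairs-map⁺ disjoint)) λ _ → ∈⊤
    where
    unique : ∀ c → IsCycle G c → Unique (vs c)
    unique (e ∷ c) (_ , u) = u

  ∈-vertices : ∀ {x d K} → d ∈ˡ K → x ∈ˡ vs d → x ∈ˡ vertices K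
  ∈-vertices {d = d} (here refl) x∈d = ∈-++⁺ˡ x∈d
  ∈-vertices {K = c ∷ K} (there d∈K) x∈d = ∈-++⁺ʳ (vs c) (∈-vertices d∈K x∈d)

  within⇒disjoint : ∀ {S} K → Within S (vertices K) → AllPairs (VertexDisjoint G) K
  within⇒disjoint []      w = []
  within⇒disjoint (c ∷ K) w with within-++⁻ (vs c) w
  ... | _ , wK = All.tabulate (λ d∈K (x∈c , x∈d) →
      x∈S∖xs⇒x∉xs (vs c) (within⇒∈ (vertices K) wK (∈-vertices d∈K x∈d)) x∈c)
    ∷ within⇒disjoint K wK

  ∈-cycles⇒cyclic : ∀ {c} → c ∈ˡ cycles G → IsCycle G c
  ∈-cycles⇒cyclic c∈ = proj₁ (proj₂ (∈-filter⁻ (λ es → isCycle? G es ×-dec startsAtLeast? G es)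
    {xs = listsUpTo #V (allFin #E)} c∈))

  -- For lists of cycles, pairwise disjointness means that the concatenated vertex lists have no
  -- repetitions. That a single cycle has none comes from its membership in `cycles G`, so the
  -- summands are compared on `sublists (cycles G)` only.
  sum-cycleSystems : sumOver (cycleSystems G) systemWeight ≡ cycleSum full (cycles G)
  sum-cycleSystems = trans
    (sumOver-filter (allPairs? (vertexDisjoint? G)) (sublists (cycles G)) systemWeight) (trans
    (sumOver-cong-∈ (sublists (cycles G)) λ {K} K∈ → cong (_* systemWeight K)
      (𝟙-cong {p = allPairs? (vertexDisjoint? G) K} {q = within? full (vertices K)}
        (disjoint⇒within λ c∈K → ∈-cycles⇒cyclic (∈-sublists (cycles G) K∈ c∈K))
        (within⇒disjoint K)))
    (cycleSum-sublists full (cycles G)))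

-- Acyclic graphs

module _ (G : Digraph) (acyclic : Acyclic G) where
  open Digraph G

  cycleSum-acyclic : ∀ ω → CycleSums.cycleSum G ω full (cycles G) ≡ 1ℤ
  cycleSum-acyclic ω = cong (CycleSums.cycleSum G ω full)
    (filter-none (λ es → isCycle? G es ×-dec startsAtLeast? G es)
      (All.tabulate {xs = listsUpTo #V (allFin #E)} λ {es} _ (cyclic , _) → acyclic es cyclic))

  -- The initial segment of the path up to u has as its sources the vertices before u, hence
  -- distinct ones other than u; this is the form of uniqueness that a cycle asks for. That the
  -- sources lie on the path keeps the starting vertex apart from the later ones in the induction.
  walk-to : ∀ {y x u} es → IsWalk G y es x → Unique (y ∷ map tgt es) → u ∈ˡ y ∷ map tgt es →
            ∃[ fs ] IsWalk G y fs u × Unique (u ∷ map src fs) × (∀ {z} → z ∈ˡ map src fs → z ∈ˡ y ∷ map tgt es)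
  walk-to es walk unique (here refl) = [] , refl , [] ∷ [] , λ ()
  walk-to (f ∷ es) (refl , walk) (y∉ ∷ unique) (there u∈)
    with walk-to es walk unique u∈
  ... | fs , walk′ , u∉ ∷ unique′ , fs⊆ =
    f ∷ fs , (refl , walk′) ,
    ((λ u≡y → All.lookup y∉ u∈ (sym u≡y)) ∷ u∉) ∷ All.tabulate (λ z∈ y≡z → All.lookup y∉ (fs⊆ z∈) y≡z) ∷ unique′ ,
    λ { (here refl) → here refl ; (there z∈) → there (fs⊆ z∈) }

  no-return : ∀ e {es x} → IsPath G (tgt e) es x → src e ∉ˡ tgt e ∷ map tgt es
  no-return e {es} (walk , unique) src-e∈ with walk-to es walk unique src-e∈
  ... | fs , walk′ , unique′ , _ = acyclic (e ∷ fs) ((refl , walk′) , unique′)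

  -- No path has more than `#V` edges, so larger bounds add nothing. The freedom in N serves
  -- `#paths-by-first-edge`, where an edge put in front of a path raises the bound to `suc #V`.
  #paths-sum : ∀ N u x → #V ℕ.≤ N →
               + #paths G u x ≡ sumOver (listsUpTo N (allFin #E)) (λ es → 𝟙 (isPath? G u es x))
  #paths-sum N u x #V≤N = trans (sumOver-length (paths G u x)) (trans
    (sumOver-filter (λ es → isPath? G u es x) (listsUpTo #V (allFin #E)) (λ _ → 1ℤ)) (trans
    (sumOver-cong (listsUpTo #V (allFin #E)) λ es → *-identityʳ (𝟙 (isPath? G u es x)))
    (extend (ℕₚ.≤⇒≤′ #V≤N))))
    where
    extend : ∀ {N} → #V ℕ.≤′ N → sumOver (listsUpTo #V (allFin #E)) (λ es → 𝟙 (isPath? G u es x)) ≡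
                              sumOver (listsUpTo N (allFin #E)) (λ es → 𝟙 (isPath? G u es x))
    extend ℕ.≤′-refl = refl
    extend (ℕ.≤′-step {N} #V≤N) = trans (extend #V≤N)
      (sym (sumOver-listsUpTo-suc N #E (λ es → 𝟙 (isPath? G u es x)) λ es N<∣es∣ →
        𝟙-no (isPath? G u es x) λ (_ , unique) → ℕₚ.<⇒≱ N<∣es∣ (ℕₚ.≤-trans (short es unique) (ℕₚ.≤′⇒≤ #V≤N))))
      where
      short : ∀ es → Unique (u ∷ map tgt es) → length es ℕ.≤ #V
      short es unique = ℕₚ.≤-trans (ℕₚ.≤-reflexive (sym (length-map tgt es))) (ℕₚ.≤-trans (ℕₚ.n≤1+n _)
        (ℕₚ.≤-trans (within⇒length (u ∷ map tgt es) (within⁺ unique λ _ → ∈⊤)) (∣p∣≤n full)))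

  -- By acyclicity a path never returns to the source of an edge put in front of it. For the
  -- adjacency matrix N and the matrix P of path counts this reads P = I + N P, so P is the inverse
  -- of I - N.
  #paths-by-first-edge : ∀ u x → + #paths G u x ≡
                         𝟙 (u ≟ x) + sum (λ e → 𝟙 (src e ≟ u) * + #paths G (tgt e) x)
  #paths-by-first-edge u x = begin
    + #paths G u x
      ≡⟨ #paths-sum (suc #V) u x (ℕₚ.n≤1+n #V) ⟩
    sumOver (listsUpTo (suc #V) (allFin #E)) (λ es → 𝟙 (isPath? G u es x))
      ≡⟨ sumOver-listsUpTo #V #E (λ es → 𝟙 (isPath? G u es x)) ⟩
    𝟙 (isPath? G u [] x) + sum (λ e → sumOver (listsUpTo #V (allFin #E)) (λ es → 𝟙 (isPath? G u (e ∷ es) x)))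
      ≡⟨ cong₂ _+_ (𝟙-cong {p = isPath? G u [] x} {q = u ≟ x} proj₁ λ u≡x → u≡x , [] ∷ []) (sum-cong-≗ term) ⟩
    𝟙 (u ≟ x) + sum (λ e → 𝟙 (src e ≟ u) * + #paths G (tgt e) x) ∎
    where
    open ≡-Reasoning
    from : ∀ e es → src e ≡ u × IsPath G (tgt e) es x → IsPath G u (e ∷ es) x
    from e es (refl , path@(walk , unique)) = (refl , walk) ,
      All.tabulate (λ { z∈ refl → no-return e path z∈ }) ∷ unique
    to : ∀ e es → IsPath G u (e ∷ es) x → src e ≡ u × IsPath G (tgt e) es x
    to e es ((src≡ , walk) , _ ∷ unique) = src≡ , walk , unique
    term : ∀ e → sumOver (listsUpTo #V (allFin #E)) (λ es → 𝟙 (isPath? G u (e ∷ es) x)) ≡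
                 𝟙 (src e ≟ u) * + #paths G (tgt e) x
    term e = trans
      (sumOver-cong (listsUpTo #V (allFin #E)) λ es → trans
        (𝟙-cong {p = isPath? G u (e ∷ es) x} {q = (src e ≟ u) ×-dec isPath? G (tgt e) es x} (to e es) (from e es))
        (𝟙-× (src e ≟ u) (isPath? G (tgt e) es x))) (trans
      (sumOver-*ˡ (𝟙 (src e ≟ u)) (listsUpTo #V (allFin #E)) (λ es → 𝟙 (isPath? G (tgt e) es x)))
      (cong (𝟙 (src e ≟ u) *_) (sym (#paths-sum #V (tgt e) x ℕₚ.≤-refl))))

-- Sums and row operations in blocks

sum-++ : ∀ m {n} (f : Fin (m ℕ.+ n) → ℤ) → sum f ≡ sum (f ∘ (_↑ˡ n)) + sum (f ∘ (m ↑ʳ_))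
sum-++ zero    f = sym (+-identityˡ (sum f))
sum-++ (suc m) f = trans (cong (_+_ (f zero)) (sum-++ m (f ∘ suc))) (sym (+-assoc (f zero) _ _))

sum-I : ∀ (i : Fin n) (x : Fin n → ℤ) → sum (λ j → I i j * x j) ≡ x i
sum-I {suc n} zero    x = trans (cong₂ _+_ (*-identityˡ (x zero)) (sum-zero λ j → *-zeroˡ (x (suc j)))) (+-identityʳ (x zero))
sum-I {suc n} (suc i) x = trans (+-identityˡ _) (trans (sum-cong-≗ λ j → cong (_* x (suc j)) (shift j)) (sum-I i (x ∘ suc)))
  where
  shift : ∀ j → I (suc i) (suc j) ≡ I i j
  shift j with i ≟ j
  ... | yes _ = refl
  ... | no  _ = refl

add-negligible-++ : (Φ : AltForm (m ℕ.+ n) C) {M M′ Z : Fin m → C → ℤ} {N N′ Y : Fin n → C → ℤ} →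
                    (∀ i → Negligible Φ (Z i)) → (∀ i → Negligible Φ (Y i)) →
                    (∀ i c → M′ i c ≡ M i c + Z i c) → (∀ i c → N′ i c ≡ N i c + Y i c) →
                    ⟦ Φ ⟧ (M′ ++ᵛ N′) ≡ ⟦ Φ ⟧ (M ++ᵛ N)
add-negligible-++ {m = m} Φ {M} {M′} {Z} {N} {N′} {Y} negZ negY eqM eqN =
  add-negligible Φ {M ++ᵛ N} {M′ ++ᵛ N′} {Z ++ᵛ Y} neg eq
  where
  neg : ∀ i → Negligible Φ ((Z ++ᵛ Y) i)
  neg i with splitAt m i
  ... | inj₁ j = negZ j
  ... | inj₂ j = negY j
  eq : ∀ i c → (M′ ++ᵛ N′) i c ≡ (M ++ᵛ N) i c + (Z ++ᵛ Y) i c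
  eq i c with splitAt m i
  ... | inj₁ j = eqM j c
  ... | inj₂ j = eqN j c

-- The quarter turn (f , g) ↦ (g , - f) is a product of three transvections.
form-quarter-turn : ∀ {k} (Φ : AltForm (k ℕ.+ k) C) (f g : Fin k → C → ℤ) →
                    ⟦ Φ ⟧ (f ++ᵛ g) ≡ ⟦ Φ ⟧ (g ++ᵛ λ i c → - f i c)
form-quarter-turn {C = C} {k = k} Φ f g = begin
  ⟦ Φ ⟧ (f ++ᵛ g)
    ≡⟨ add-negligible (fixLower g Φ) {f+g} {f} {λ i c → -1ℤ * g i c}
         (λ i → negligible-scale -1ℤ (negligible-lower Φ g i)) (λ i c → minus (f i c) (g i c)) ⟩
  ⟦ Φ ⟧ (f+g ++ᵛ g)
    ≡⟨ add-negligible (fixUpper f+g Φ) { -f} {g} {λ i c → 1ℤ * f+g i c}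
         (λ i → negligible-scale 1ℤ (negligible-upper Φ f+g i)) (λ i c → plus (f i c) (g i c)) ⟩
  ⟦ Φ ⟧ (f+g ++ᵛ -f)
    ≡⟨ add-negligible (fixLower -f Φ) {g} {f+g} {λ i c → -1ℤ * -f i c}
         (λ i → negligible-scale -1ℤ (negligible-lower Φ -f i)) (λ i c → minus′ (f i c) (g i c)) ⟩
  ⟦ Φ ⟧ (g ++ᵛ -f) ∎
  where
  open ≡-Reasoning
  f+g -f : Fin k → C → ℤ
  f+g i c = f i c + g i c
  -f  i c = - f i c
  minus : ∀ x y → x ≡ x + y + -1ℤ * y
  minus = solve-∀
  plus : ∀ x y → y ≡ - x + 1ℤ * (x + y)
  plus = solve-∀
  minus′ : ∀ x y → x + y ≡ y + -1ℤ * - x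
  minus′ = solve-∀

^-length-filter-∷ : ∀ {X : Set} {R : X → Set} (R? : Decidable R) x xs →
                    -1ℤ ^ length (filter R? (x ∷ xs)) ≡
                    (if does (R? x) then -1ℤ else 1ℤ) * -1ℤ ^ length (filter R? xs)
^-length-filter-∷ R? x xs with R? x
... | yes _ = refl
... | no  _ = sym (*-identityˡ (-1ℤ ^ length (filter R? xs)))

unit : (G : Digraph) → Digraph.Edge G → ℤ
unit G e = 1ℤ

module _ (G : Digraph) (acyclic : Acyclic G) where
  open Digraph G

  form-stepRow-acyclic : (Φ : AltForm #V C) (b : Vertex → C → ℤ) →
                         ⟦ Φ ⟧ (stepRow G (unit G) Φ b) ≡ ⟦ Φ ⟧ b
  form-stepRow-acyclic Φ b = trans (form-stepRow G (unit G) Φ b)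
    (trans (cong (_* ⟦ Φ ⟧ b) (cycleSum-acyclic G acyclic (unit G))) (*-identityˡ (⟦ Φ ⟧ b)))

  -- Since P = I + N P, applying I - N to x + P f, where P counts the paths to the `d j`, leaves (I
  -- - N) x with `f j` added at `d j`. Vectors are treated one column at a time, so x and f are
  -- scalar here.
  path-recursion : ∀ {k} (d : Fin k → Vertex) (x : Vertex → ℤ) (f : Fin k → ℤ) u →
    let p = λ u → x u + sum (λ j → + #paths G u (d j) * f j) in
    p u - sum (λ e → 𝟙 (src e ≟ u) * 1ℤ * p (tgt e)) ≡
    x u - sum (λ e → 𝟙 (src e ≟ u) * 1ℤ * x (tgt e)) + sum (λ j → 𝟙 (u ≟ d j) * f j)
  path-recursion d x f u = begin
    x u + π u - sum (λ e → σ e * (x (tgt e) + π (tgt e)))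
      ≡⟨ cong (λ s → x u + π u - s) (trans (sum-cong-≗ λ e → distrib (σ e) (x (tgt e)) (π (tgt e)))
           (sum-linear 1ℤ 1ℤ (λ e → σ e * x (tgt e)) (λ e → σ e * π (tgt e)))) ⟩
    x u + π u - (1ℤ * E + 1ℤ * Σπ)
      ≡⟨ cong (λ s → x u + s - (1ℤ * E + 1ℤ * Σπ)) expand ⟩
    x u + (1ℤ * Δ + 1ℤ * Σπ) - (1ℤ * E + 1ℤ * Σπ)
      ≡⟨ arrange (x u) Δ E Σπ ⟩
    x u - E + Δ ∎
    where
    open ≡-Reasoning
    π : Vertex → ℤ
    π u = sum (λ j → + #paths G u (d j) * f j)
    σ : Edge → ℤ
    σ e = 𝟙 (src e ≟ u) * 1ℤ
    E  = sum (λ e → σ e * x (tgt e))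
    Σπ = sum (λ e → σ e * π (tgt e))
    Δ  = sum (λ j → 𝟙 (u ≟ d j) * f j)
    distrib : ∀ s x y → s * (x + y) ≡ 1ℤ * (s * x) + 1ℤ * (s * y)
    distrib = solve-∀
    arrange : ∀ x d y p → x + (1ℤ * d + 1ℤ * p) - (1ℤ * y + 1ℤ * p) ≡ x - y + d
    arrange = solve-∀
    arrange′ : ∀ s a f → s * a * f ≡ s * 1ℤ * (a * f)
    arrange′ = solve-∀
    distrib′ : ∀ i s f → (i + s) * f ≡ 1ℤ * (i * f) + 1ℤ * (s * f)
    distrib′ = solve-∀
    later : Fin _ → ℤ
    later j = sum (λ e → 𝟙 (src e ≟ u) * + #paths G (tgt e) (d j))
    expand : π u ≡ 1ℤ * Δ + 1ℤ * Σπ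
    expand = begin
      π u
        ≡⟨ sum-cong-≗ (λ j → trans (cong (_* f j) (#paths-by-first-edge G acyclic u (d j)))
             (distrib′ (𝟙 (u ≟ d j)) (later j) (f j))) ⟩
      sum (λ j → 1ℤ * (𝟙 (u ≟ d j) * f j) + 1ℤ * (later j * f j))
        ≡⟨ sum-linear 1ℤ 1ℤ (λ j → 𝟙 (u ≟ d j) * f j) (λ j → later j * f j) ⟩
      1ℤ * Δ + 1ℤ * sum (λ j → later j * f j)
        ≡⟨ cong (λ s → 1ℤ * Δ + 1ℤ * s) (trans
             (sum-cong-≗ λ j → trans
               (*-distribʳ-sum (f j) (λ e → 𝟙 (src e ≟ u) * + #paths G (tgt e) (d j)))
               (sum-cong-≗ λ e → arrange′ (𝟙 (src e ≟ u)) (+ #paths G (tgt e) (d j)) (f j))) (trans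
             (∑-comm (λ j e → σ e * (+ #paths G (tgt e) (d j) * f j)))
             (sum-cong-≗ λ e → sym (*-distribˡ-sum (σ e) (λ j → + #paths G (tgt e) (d j) * f j))))) ⟩
      1ℤ * Δ + 1ℤ * Σπ ∎

-- Hamburger graphs

module _ {k : ℕ} (H : HamburgerGraph k) where
  open HamburgerGraph H
  private
    module G₁ = Digraph G₁
    module G₂ = Digraph G₂

  crossingWeight : Edge → ℤ
  crossingWeight e = if does (fromG₂ToG₁? e) then -1ℤ else 1ℤ

  open CycleSums graph crossingWeight using (weight; cycleSum)

  weight-crossings : ∀ es → weight es ≡ -1ℤ ^ length (filter fromG₂ToG₁? es)
  weight-crossings []       = refl
  weight-crossings (e ∷ es) = trans (cong (crossingWeight e *_) (weight-crossings es))
    (sym (^-length-filter-∷ fromG₂ToG₁? e es))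

  -- The factors (-1)^l come from the weights of the edges, and the factors (-1)^m from the minus
  -- sign that `systemWeight` gives to each cycle.
  systemWeight-sign : ∀ K → systemWeight graph crossingWeight K ≡ sign K
  systemWeight-sign []      = refl
  systemWeight-sign (c ∷ K) = begin
    - weight c * systemWeight graph crossingWeight K
      ≡⟨ cong₂ (λ x y → - x * y) (weight-crossings c) (systemWeight-sign K) ⟩
    - (-1ℤ ^ l) * -1ℤ ^ (l′ ℕ.+ m′)
      ≡⟨ cong (- (-1ℤ ^ l) *_) (^-distribˡ-+-* -1ℤ l′ m′) ⟩
    - (-1ℤ ^ l) * (-1ℤ ^ l′ * -1ℤ ^ m′)
      ≡⟨ arrange (-1ℤ ^ l) (-1ℤ ^ l′) (-1ℤ ^ m′) ⟩
    -1ℤ ^ l * -1ℤ ^ l′ * (-1ℤ * -1ℤ ^ m′)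
      ≡⟨ cong (_* (-1ℤ * -1ℤ ^ m′)) (^-distribˡ-+-* -1ℤ l l′) ⟨
    -1ℤ ^ (l ℕ.+ l′) * -1ℤ ^ suc m′
      ≡⟨ ^-distribˡ-+-* -1ℤ (l ℕ.+ l′) (suc m′) ⟨
    -1ℤ ^ (l ℕ.+ l′ ℕ.+ suc m′)
      ≡⟨ cong (λ x → -1ℤ ^ (x ℕ.+ suc m′)) (trans (cong length (filter-++ fromG₂ToG₁? c (concat K)))
           (length-++ (filter fromG₂ToG₁? c))) ⟨
    sign (c ∷ K) ∎
    where
    open ≡-Reasoning
    l  = length (filter fromG₂ToG₁? c)
    l′ = length (filter fromG₂ToG₁? (concat K))
    m′ = length K
    arrange : ∀ x y z → - x * (y * z) ≡ x * y * (-1ℤ * z)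
    arrange = solve-∀

  -- This turns the sum of the signs into a difference of two counts; it rests on a power of -1
  -- being 1 or -1.
  sign-±1 : ∀ K → 1ℤ * 𝟙 (sign K ℤₚ.≟ 1ℤ) + -1ℤ * 𝟙 (sign K ℤₚ.≟ -1ℤ) ≡ sign K
  sign-±1 K = power (length (filter fromG₂ToG₁? (concat K)) ℕ.+ length K)
    where
    ±1 : ∀ n → -1ℤ ^ n ≡ 1ℤ ⊎ -1ℤ ^ n ≡ -1ℤ
    ±1 zero    = inj₁ refl
    ±1 (suc n) with ±1 n
    ... | inj₁ eq = inj₂ (cong (-1ℤ *_) eq)
    ... | inj₂ eq = inj₁ (cong (-1ℤ *_) eq)
    power : ∀ n → 1ℤ * 𝟙 (-1ℤ ^ n ℤₚ.≟ 1ℤ) + -1ℤ * 𝟙 (-1ℤ ^ n ℤₚ.≟ -1ℤ) ≡ -1ℤ ^ n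
    power n with -1ℤ ^ n | ±1 n
    ... | _ | inj₁ refl = refl
    ... | _ | inj₂ refl = refl

  cycleSum-c⁺-c⁻ : cycleSum full (cycles graph) ≡ + c⁺ - + c⁻
  cycleSum-c⁺-c⁻ = begin
    cycleSum full (cycles graph)
      ≡⟨ sum-cycleSystems graph crossingWeight ⟨
    sumOver K (systemWeight graph crossingWeight)
      ≡⟨ sumOver-cong K (λ C → trans (systemWeight-sign C) (sym (sign-±1 C))) ⟩
    sumOver K (λ C → 1ℤ * 𝟙 (sign C ℤₚ.≟ 1ℤ) + -1ℤ * 𝟙 (sign C ℤₚ.≟ -1ℤ))
      ≡⟨ sumOver-linear 1ℤ -1ℤ K (λ C → 𝟙 (sign C ℤₚ.≟ 1ℤ)) (λ C → 𝟙 (sign C ℤₚ.≟ -1ℤ)) ⟩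
    1ℤ * sumOver K (λ C → 𝟙 (sign C ℤₚ.≟ 1ℤ)) + -1ℤ * sumOver K (λ C → 𝟙 (sign C ℤₚ.≟ -1ℤ))
      ≡⟨ cong₂ (λ x y → 1ℤ * x + -1ℤ * y) (count 1ℤ) (count -1ℤ) ⟨
    1ℤ * + c⁺ + -1ℤ * + c⁻
      ≡⟨ signs (+ c⁺) (+ c⁻) ⟨
    + c⁺ - + c⁻ ∎
    where
    open ≡-Reasoning
    K = cycleSystems graph
    signs : ∀ x y → x - y ≡ 1ℤ * x + -1ℤ * y
    signs = solve-∀
    count : ∀ s → + length (filter (λ C → sign C ℤₚ.≟ s) K) ≡ sumOver K (λ C → 𝟙 (sign C ℤₚ.≟ s))
    count s = trans (sumOver-length (filter (λ C → sign C ℤₚ.≟ s) K)) (trans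
      (sumOver-filter (λ C → sign C ℤₚ.≟ s) K (λ _ → 1ℤ))
      (sumOver-cong K λ C → *-identityʳ (𝟙 (sign C ℤₚ.≟ s))))

  -- The edges of a hamburger graph by kind

  private
    inG₁ : G₁.Vertex → Vertex
    inG₁ = _↑ˡ G₂.#V
    inG₂ : G₂.Vertex → Vertex
    inG₂ = G₁.#V ↑ʳ_

    edge₁ : G₁.Edge → Edge
    edge₁ = _↑ˡ (G₂.#E ℕ.+ (k ℕ.+ k))
    edge₂ : G₂.Edge → Edge
    edge₂ e = G₁.#E ↑ʳ (e ↑ˡ (k ℕ.+ k))
    edge-v edge-w : Fin k → Edge
    edge-v i = G₁.#E ↑ʳ (G₂.#E ↑ʳ (i ↑ˡ k))
    edge-w i = G₁.#E ↑ʳ (G₂.#E ↑ʳ (k ↑ʳ i))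

  module _ {x₁ : G₁.Edge → Vertex} {x₂ : G₂.Edge → Vertex} {x₃ x₄ : Fin k → Vertex} where
    private
      ends : Edge → Vertex
      ends = x₁ ++ᵛ x₂ ++ᵛ x₃ ++ᵛ x₄

    ends-edge₁ : ∀ e → ends (edge₁ e) ≡ x₁ e
    ends-edge₁ e = lookup-++ˡ x₁ (x₂ ++ᵛ x₃ ++ᵛ x₄) e

    ends-edge₂ : ∀ e → ends (edge₂ e) ≡ x₂ e
    ends-edge₂ e = trans (lookup-++ʳ x₁ (x₂ ++ᵛ x₃ ++ᵛ x₄) (e ↑ˡ (k ℕ.+ k))) (lookup-++ˡ x₂ (x₃ ++ᵛ x₄) e)

    ends-edge-v : ∀ i → ends (edge-v i) ≡ x₃ i
    ends-edge-v i = trans (lookup-++ʳ x₁ (x₂ ++ᵛ x₃ ++ᵛ x₄) (G₂.#E ↑ʳ (i ↑ˡ k)))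
      (trans (lookup-++ʳ x₂ (x₃ ++ᵛ x₄) (i ↑ˡ k)) (lookup-++ˡ x₃ x₄ i))

    ends-edge-w : ∀ i → ends (edge-w i) ≡ x₄ i
    ends-edge-w i = trans (lookup-++ʳ x₁ (x₂ ++ᵛ x₃ ++ᵛ x₄) (G₂.#E ↑ʳ (k ↑ʳ i)))
      (trans (lookup-++ʳ x₂ (x₃ ++ᵛ x₄) (k ↑ʳ i)) (lookup-++ʳ x₃ x₄ i))

  sum-edges : ∀ (h : Vertex → Vertex → ℤ) →
    sum (λ e → h (src e) (tgt e)) ≡
    sum (λ e → h (inG₁ (G₁.src e)) (inG₁ (G₁.tgt e))) +
    (sum (λ e → h (inG₂ (G₂.src e)) (inG₂ (G₂.tgt e))) +
    (sum (λ i → h (inG₁ (v i)) (inG₂ (w i))) + sum (λ i → h (inG₂ (w i)) (inG₁ (v i)))))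
  sum-edges h = trans (sum-++ G₁.#E h′) (cong₂ _+_
    (sum-cong-≗ λ e → cong₂ h (ends-edge₁ e) (ends-edge₁ e))
    (trans (sum-++ G₂.#E (h′ ∘ (G₁.#E ↑ʳ_))) (cong₂ _+_
      (sum-cong-≗ λ e → cong₂ h (ends-edge₂ e) (ends-edge₂ e))
      (trans (sum-++ k (h′ ∘ (G₁.#E ↑ʳ_) ∘ (G₂.#E ↑ʳ_))) (cong₂ _+_
        (sum-cong-≗ λ i → cong₂ h (ends-edge-v i) (ends-edge-v i))
        (sum-cong-≗ λ i → cong₂ h (ends-edge-w i) (ends-edge-w i)))))))
    where
    h′ : Edge → ℤ
    h′ e = h (src e) (tgt e)

  private
    -- `crossingWeight e` is `ω (src e) (tgt e)` by definition. Depending on the ends alone, it can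
    -- be evaluated for each kind of edge after `sum-edges`.
    ω : Vertex → Vertex → ℤ
    ω s t = if does ((G₁.#V ℕₚ.≤? toℕ s) ×-dec (toℕ t ℕₚ.<? G₁.#V)) then -1ℤ else 1ℤ

    ω-inG₁ : ∀ u t → ω (inG₁ u) t ≡ 1ℤ
    ω-inG₁ u t = cong (λ x → if x then -1ℤ else 1ℤ) (dec-false ((G₁.#V ℕₚ.≤? toℕ (inG₁ u)) ×-dec (toℕ t ℕₚ.<? G₁.#V))
      λ (n₁≤u , _) → ℕₚ.<⇒≱ (toℕ<n u) (subst (G₁.#V ℕ.≤_) (toℕ-↑ˡ u G₂.#V) n₁≤u))

    ω-inG₂-inG₂ : ∀ u t → ω (inG₂ u) (inG₂ t) ≡ 1ℤ
    ω-inG₂-inG₂ u t = cong (λ x → if x then -1ℤ else 1ℤ)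
      (dec-false ((G₁.#V ℕₚ.≤? toℕ (inG₂ u)) ×-dec (toℕ (inG₂ t) ℕₚ.<? G₁.#V))
      λ (_ , t<n₁) → ℕₚ.<⇒≱ (subst (ℕ._< G₁.#V) (toℕ-↑ʳ G₁.#V t) t<n₁) (ℕₚ.m≤m+n G₁.#V (toℕ t)))

    ω-inG₂-inG₁ : ∀ u t → ω (inG₂ u) (inG₁ t) ≡ -1ℤ
    ω-inG₂-inG₁ u t = cong (λ x → if x then -1ℤ else 1ℤ)
      (dec-true ((G₁.#V ℕₚ.≤? toℕ (inG₂ u)) ×-dec (toℕ (inG₁ t) ℕₚ.<? G₁.#V))
      (subst (G₁.#V ℕ.≤_) (sym (toℕ-↑ʳ G₁.#V u)) (ℕₚ.m≤m+n G₁.#V (toℕ u)) ,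
       subst (ℕ._< G₁.#V) (sym (toℕ-↑ˡ t G₂.#V)) (toℕ<n t)))

  module _ (x₁ : G₁.Vertex → ℤ) (x₂ : G₂.Vertex → ℤ) (x : Vertex → ℤ)
           (x-inG₁ : ∀ u → x (inG₁ u) ≡ x₁ u) (x-inG₂ : ∀ u → x (inG₂ u) ≡ x₂ u) where

    private
      term : Vertex → Vertex → Vertex → ℤ
      term u s t = 𝟙 (s ≟ u) * ω s t * x t

      vanish : ∀ {u s t} → s ≢ u → term u s t ≡ 0ℤ
      vanish {u} {s} {t} s≢u = cong (λ i → i * ω s t * x t) (𝟙-no (s ≟ u) s≢u)

      term-cong : ∀ {u s t i a y} → 𝟙 (s ≟ u) ≡ i → ω s t ≡ a → x t ≡ y → term u s t ≡ i * a * y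
      term-cong refl refl refl = refl

      𝟙-inG₁ : ∀ s u → 𝟙 (inG₁ s ≟ inG₁ u) ≡ 𝟙 (s ≟ u)
      𝟙-inG₁ s u = 𝟙-cong {p = inG₁ s ≟ inG₁ u} {q = s ≟ u} (↑ˡ-injective G₂.#V s u) (cong inG₁)

      𝟙-inG₂ : ∀ s u → 𝟙 (inG₂ s ≟ inG₂ u) ≡ 𝟙 (s ≟ u)
      𝟙-inG₂ s u = 𝟙-cong {p = inG₂ s ≟ inG₂ u} {q = s ≟ u} (↑ʳ-injective G₁.#V s u) (cong inG₂)

    edge-sum-inG₁ : ∀ u → sum (λ e → 𝟙 (src e ≟ inG₁ u) * crossingWeight e * x (tgt e)) ≡
      sum (λ e → 𝟙 (G₁.src e ≟ u) * 1ℤ * x₁ (G₁.tgt e)) + sum (λ i → 𝟙 (v i ≟ u) * x₂ (w i))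
    edge-sum-inG₁ u = trans (sum-edges (term (inG₁ u))) (trans
      (cong₂ _+_
        (sum-cong-≗ λ e → term-cong (𝟙-inG₁ (G₁.src e) u) (ω-inG₁ (G₁.src e) (inG₁ (G₁.tgt e))) (x-inG₁ (G₁.tgt e)))
        (cong₂ _+_ (sum-zero λ e → vanish (↑ˡ≢↑ʳ u (G₂.src e) ∘ sym)) (cong₂ _+_
          (sum-cong-≗ λ i → trans (term-cong (𝟙-inG₁ (v i) u) (ω-inG₁ (v i) (inG₂ (w i))) (x-inG₂ (w i)))
            (cong (_* x₂ (w i)) (*-identityʳ (𝟙 (v i ≟ u)))))
          (sum-zero λ i → vanish (↑ˡ≢↑ʳ u (w i) ∘ sym)))))
      (drop-zeros (sum (λ e → 𝟙 (G₁.src e ≟ u) * 1ℤ * x₁ (G₁.tgt e))) (sum (λ i → 𝟙 (v i ≟ u) * x₂ (w i)))))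
      where
      drop-zeros : ∀ a b → a + (0ℤ + (b + 0ℤ)) ≡ a + b
      drop-zeros = solve-∀

    edge-sum-inG₂ : ∀ u → sum (λ e → 𝟙 (src e ≟ inG₂ u) * crossingWeight e * x (tgt e)) ≡
      sum (λ e → 𝟙 (G₂.src e ≟ u) * 1ℤ * x₂ (G₂.tgt e)) + - sum (λ i → 𝟙 (w i ≟ u) * x₁ (v i))
    edge-sum-inG₂ u = trans (sum-edges (term (inG₂ u))) (trans
      (cong₂ _+_
        (sum-zero λ e → vanish (↑ˡ≢↑ʳ (G₁.src e) u))
        (cong₂ _+_
          (sum-cong-≗ λ e → term-cong (𝟙-inG₂ (G₂.src e) u) (ω-inG₂-inG₂ (G₂.src e) (G₂.tgt e)) (x-inG₂ (G₂.tgt e)))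
          (cong₂ _+_ (sum-zero λ i → vanish (↑ˡ≢↑ʳ (v i) u))
            (trans (sum-cong-≗ λ i → trans (term-cong (𝟙-inG₂ (w i) u) (ω-inG₂-inG₁ (w i) (v i)) (x-inG₁ (v i)))
                (negate (𝟙 (w i ≟ u)) (x₁ (v i))))
              (sum-neg (λ i → 𝟙 (w i ≟ u) * x₁ (v i)))))))
      (drop-zeros (sum (λ e → 𝟙 (G₂.src e ≟ u) * 1ℤ * x₂ (G₂.tgt e))) (- sum (λ i → 𝟙 (w i ≟ u) * x₁ (v i)))))
      where
      drop-zeros : ∀ a b → 0ℤ + (a + (0ℤ + b)) ≡ a + b
      drop-zeros = solve-∀
      negate : ∀ i y → i * -1ℤ * y ≡ - (i * y)
      negate = solve-∀

  -- Two evaluations of one form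

  module _ {C : Set} (Φ : AltForm (#V ℕ.+ (k ℕ.+ k)) C)
           (e₁ : G₁.Vertex → C → ℤ) (e₂ : G₂.Vertex → C → ℤ) (f g : Fin k → C → ℤ) where

    private
      e : Vertex → C → ℤ
      e = e₁ ++ᵛ e₂

      h : Fin (k ℕ.+ k) → C → ℤ
      h = f ++ᵛ g

      -f : Fin k → C → ℤ
      -f i c = - f i c

      -- The signs are forced by the crossing edges: the edge from `v i` to `w i` puts - w_i = f_i +
      -- b_i into its row, and the edge back, of weight -1, puts v_i = g_i - a_i. They also make
      -- `p₁ (v i)` and `p₂ (w i)` complete `a i` and `b i` to the rows of (A, I) and (-I, B).
      a b : Fin k → C → ℤ
      a i c = g i c - e₁ (v i) c
      b i c = - f i c - e₂ (w i) c

      p₁ : G₁.Vertex → C → ℤ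
      p₁ u c = e₁ u c + sum (λ j → + #paths G₁ u (v j) * f j c)
      p₂ : G₂.Vertex → C → ℤ
      p₂ u c = e₂ u c + sum (λ j → + #paths G₂ u (w j) * g j c)

      Φ₁ : (G₂.Vertex → C → ℤ) → AltForm G₁.#V C
      Φ₁ x₂ = fixLower x₂ (fixLower (a ++ᵛ b) Φ)
      Φ₂ : (G₁.Vertex → C → ℤ) → AltForm G₂.#V C
      Φ₂ x₁ = fixUpper x₁ (fixLower (a ++ᵛ b) Φ)

      -- The form is a dummy argument of stepRow.
      y₁ : G₁.Vertex → C → ℤ
      y₁ = stepRow G₁ (unit G₁) (Φ₁ p₂) p₁
      y₂ : G₂.Vertex → C → ℤ
      y₂ = stepRow G₂ (unit G₂) (Φ₂ p₁) p₂

      r : Vertex → C → ℤ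
      r = stepRow graph crossingWeight (fixLower (a ++ᵛ b) Φ) e

      r₁ : G₁.Vertex → C → ℤ
      r₁ u c = e₁ u c - (sum (λ x → 𝟙 (G₁.src x ≟ u) * 1ℤ * e₁ (G₁.tgt x) c) + sum (λ i → 𝟙 (v i ≟ u) * e₂ (w i) c))
      r₂ : G₂.Vertex → C → ℤ
      r₂ u c = e₂ u c - (sum (λ x → 𝟙 (G₂.src x ≟ u) * 1ℤ * e₂ (G₂.tgt x) c) + - sum (λ i → 𝟙 (w i ≟ u) * e₁ (v i) c))

    open ≡-Reasoning

    private
      r-blocks : r ≋ (r₁ ++ᵛ r₂)
      r-blocks = ≋-by-blocks
        (λ u c → trans (cong₂ _-_ (++-at-↑ˡ e₁ e₂ u c)
          (edge-sum-inG₁ (λ u → e₁ u c) (λ u → e₂ u c) (λ u → e u c) (λ u → ++-at-↑ˡ e₁ e₂ u c) (λ u → ++-at-↑ʳ e₁ e₂ u c) u))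
          (sym (++-at-↑ˡ r₁ r₂ u c)))
        (λ u c → trans (cong₂ _-_ (++-at-↑ʳ e₁ e₂ u c)
          (edge-sum-inG₂ (λ u → e₁ u c) (λ u → e₂ u c) (λ u → e u c) (λ u → ++-at-↑ˡ e₁ e₂ u c) (λ u → ++-at-↑ʳ e₁ e₂ u c) u))
          (sym (++-at-↑ʳ r₁ r₂ u c)))

      𝟙-sym : ∀ {n} (i j : Fin n) → 𝟙 (i ≟ j) ≡ 𝟙 (j ≟ i)
      𝟙-sym i j = 𝟙-cong {p = i ≟ j} {q = j ≟ i} sym sym

      r₁-y₁ : ∀ u c → r₁ u c ≡ y₁ u c + sum (λ i → 𝟙 (v i ≟ u) * b i c)
      r₁-y₁ u c = sym (begin
        y₁ u c + sum (λ i → 𝟙 (v i ≟ u) * b i c)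
          ≡⟨ cong₂ _+_ (path-recursion G₁ G₁-acyclic v (λ u → e₁ u c) (λ j → f j c) u) (trans
               (sum-cong-≗ λ i → distrib (𝟙 (v i ≟ u)) (f i c) (e₂ (w i) c))
               (sum-linear -1ℤ -1ℤ (λ i → 𝟙 (v i ≟ u) * f i c) (λ i → 𝟙 (v i ≟ u) * e₂ (w i) c))) ⟩
        e₁ u c - E + sum (λ i → 𝟙 (u ≟ v i) * f i c) + (-1ℤ * F + -1ℤ * W)
          ≡⟨ cong (λ s → e₁ u c - E + s + (-1ℤ * F + -1ℤ * W)) (sum-cong-≗ λ i → cong (_* f i c) (𝟙-sym u (v i))) ⟩
        e₁ u c - E + F + (-1ℤ * F + -1ℤ * W)
          ≡⟨ arrange (e₁ u c) E F W ⟩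
        r₁ u c ∎)
        where
        E = sum (λ x → 𝟙 (G₁.src x ≟ u) * 1ℤ * e₁ (G₁.tgt x) c)
        F = sum (λ i → 𝟙 (v i ≟ u) * f i c)
        W = sum (λ i → 𝟙 (v i ≟ u) * e₂ (w i) c)
        distrib : ∀ i x y → i * (- x - y) ≡ -1ℤ * (i * x) + -1ℤ * (i * y)
        distrib = solve-∀
        arrange : ∀ x y z t → x - y + z + (-1ℤ * z + -1ℤ * t) ≡ x - (y + t)
        arrange = solve-∀

      r₂-y₂ : ∀ u c → r₂ u c ≡ y₂ u c + -1ℤ * sum (λ i → 𝟙 (w i ≟ u) * a i c)
      r₂-y₂ u c = sym (begin
        y₂ u c + -1ℤ * sum (λ i → 𝟙 (w i ≟ u) * a i c)
          ≡⟨ cong₂ (λ s t → s + -1ℤ * t) (path-recursion G₂ G₂-acyclic w (λ u → e₂ u c) (λ j → g j c) u) (trans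
               (sum-cong-≗ λ i → distrib (𝟙 (w i ≟ u)) (g i c) (e₁ (v i) c))
               (sum-linear 1ℤ -1ℤ (λ i → 𝟙 (w i ≟ u) * g i c) (λ i → 𝟙 (w i ≟ u) * e₁ (v i) c))) ⟩
        e₂ u c - E + sum (λ i → 𝟙 (u ≟ w i) * g i c) + -1ℤ * (1ℤ * F + -1ℤ * W)
          ≡⟨ cong (λ s → e₂ u c - E + s + -1ℤ * (1ℤ * F + -1ℤ * W)) (sum-cong-≗ λ i → cong (_* g i c) (𝟙-sym u (w i))) ⟩
        e₂ u c - E + F + -1ℤ * (1ℤ * F + -1ℤ * W)
          ≡⟨ arrange (e₂ u c) E F W ⟩
        r₂ u c ∎)
        where
        E = sum (λ x → 𝟙 (G₂.src x ≟ u) * 1ℤ * e₂ (G₂.tgt x) c)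
        F = sum (λ i → 𝟙 (w i ≟ u) * g i c)
        W = sum (λ i → 𝟙 (w i ≟ u) * e₁ (v i) c)
        distrib : ∀ i x y → i * (x - y) ≡ 1ℤ * (i * x) + -1ℤ * (i * y)
        distrib = solve-∀
        arrange : ∀ x y z t → x - y + z + -1ℤ * (1ℤ * z + -1ℤ * t) ≡ x - (y + - t)
        arrange = solve-∀

      negligible-↑ˡ : ∀ x y i → Negligible (fixLower {m = #V} (x ++ᵛ y) Φ) (x i)
      negligible-↑ˡ x y i = subst (Negligible (fixLower {m = #V} (x ++ᵛ y) Φ)) (lookup-++ˡ x y i)
        (negligible-lower {m = #V} Φ (x ++ᵛ y) (i ↑ˡ k))

      negligible-↑ʳ : ∀ x y i → Negligible (fixLower {m = #V} (x ++ᵛ y) Φ) (y i)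
      negligible-↑ʳ x y i = subst (Negligible (fixLower {m = #V} (x ++ᵛ y) Φ)) (lookup-++ʳ x y i)
        (negligible-lower {m = #V} Φ (x ++ᵛ y) (k ↑ʳ i))

      negligible-inG₁ : ∀ x₁ x₂ u → Negligible (fixUpper {n = k ℕ.+ k} (x₁ ++ᵛ x₂) Φ) (x₁ u)
      negligible-inG₁ x₁ x₂ u = subst (Negligible (fixUpper {n = k ℕ.+ k} (x₁ ++ᵛ x₂) Φ)) (lookup-++ˡ x₁ x₂ u)
        (negligible-upper {n = k ℕ.+ k} Φ (x₁ ++ᵛ x₂) (inG₁ u))

      negligible-inG₂ : ∀ x₁ x₂ u → Negligible (fixUpper {n = k ℕ.+ k} (x₁ ++ᵛ x₂) Φ) (x₂ u)
      negligible-inG₂ x₁ x₂ u = subst (Negligible (fixUpper {n = k ℕ.+ k} (x₁ ++ᵛ x₂) Φ)) (lookup-++ʳ x₁ x₂ u)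
        (negligible-upper {n = k ℕ.+ k} Φ (x₁ ++ᵛ x₂) (inG₂ u))

    form-by-cycles : ⟦ Φ ⟧ (r ++ᵛ (a ++ᵛ b)) ≡ cycleSum full (cycles graph) * ⟦ Φ ⟧ (e ++ᵛ h)
    form-by-cycles = begin
      ⟦ Φ ⟧ (r ++ᵛ (a ++ᵛ b))
        ≡⟨ form-stepRow graph crossingWeight (fixLower (a ++ᵛ b) Φ) e ⟩
      cycleSum full (cycles graph) * ⟦ Φ ⟧ (e ++ᵛ (a ++ᵛ b))
        ≡⟨ cong (cycleSum full (cycles graph) *_) (begin
             ⟦ Φ ⟧ (e ++ᵛ (a ++ᵛ b))
               -- The basis vectors of the vertices are now rows themselves, so only the parts g and
               -- - f of the rows a and b count.
               ≡⟨ add-negligible-++ (fixUpper e Φ) {g} {a} {λ i c → -1ℤ * e₁ (v i) c} { -f} {b} {λ i c → -1ℤ * e₂ (w i) c}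
                    (λ i → negligible-scale -1ℤ (negligible-inG₁ e₁ e₂ (v i)))
                    (λ i → negligible-scale -1ℤ (negligible-inG₂ e₁ e₂ (w i)))
                    (λ i c → signs (g i c) (e₁ (v i) c)) (λ i c → signs (- f i c) (e₂ (w i) c)) ⟩
             ⟦ Φ ⟧ (e ++ᵛ (g ++ᵛ -f))
               ≡⟨ form-quarter-turn (fixUpper e Φ) f g ⟨
             ⟦ Φ ⟧ (e ++ᵛ h) ∎) ⟩
      cycleSum full (cycles graph) * ⟦ Φ ⟧ (e ++ᵛ h) ∎
      where
      signs : ∀ x y → x - y ≡ x + -1ℤ * y
      signs = solve-∀

    private
      A B : Matrix k
      A i j = + #paths G₁ (v i) (v j)
      B i j = + #paths G₂ (w i) (w j)

      M : Matrix (k ℕ.+ k)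
      M = hamburgerMatrix H

      Mh : Fin (k ℕ.+ k) → C → ℤ
      Mh i c = sum (λ j → M i j * h j c)

      q₁ q₂ : Fin k → C → ℤ
      q₁ i c = sum (λ j → A i j * f j c) + g i c
      q₂ i c = - f i c + sum (λ j → B i j * g j c)

      row-product : ∀ (x : Fin (k ℕ.+ k) → ℤ) (s t : Fin k → ℤ) → (∀ j → x j ≡ (s ++ᵛ t) j) → ∀ c →
                    sum (λ j → x j * h j c) ≡ sum (λ j → s j * f j c) + sum (λ j → t j * g j c)
      row-product x s t x≡ c = trans (sum-++ k (λ j → x j * h j c)) (cong₂ _+_
        (sum-cong-≗ λ j → cong₂ _*_ (trans (x≡ (j ↑ˡ k)) (lookup-++ˡ s t j)) (++-at-↑ˡ f g j c))
        (sum-cong-≗ λ j → cong₂ _*_ (trans (x≡ (k ↑ʳ j)) (lookup-++ʳ s t j)) (++-at-↑ʳ f g j c)))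

      Mh-blocks : Mh ≋ (q₁ ++ᵛ q₂)
      Mh-blocks = ≋-by-blocks
        (λ i c → trans (row-product (M (i ↑ˡ k)) (A i) (I i)
            (λ j → cong (λ x → x j) (lookup-++ˡ upper lower i)) c)
          (trans (cong (_+_ (sum (λ j → A i j * f j c))) (sum-I i (λ j → g j c))) (sym (++-at-↑ˡ q₁ q₂ i c))))
        (λ i c → trans (row-product (M (k ↑ʳ i)) (λ j → - I i j) (B i)
            (λ j → cong (λ x → x j) (lookup-++ʳ upper lower i)) c)
          (trans (cong (_+ sum (λ j → B i j * g j c)) (trans
              (sum-cong-≗ λ j → sym (neg-distribˡ-* (I i j) (f j c))) (trans
              (sum-neg (λ j → I i j * f j c)) (cong -_ (sum-I i (λ j → f j c))))))
            (sym (++-at-↑ʳ q₁ q₂ i c))))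
        where
        upper lower : Fin k → Fin (k ℕ.+ k) → ℤ
        upper = λ i → A i ++ᵛ I i
        lower = λ i → (λ j → - I i j) ++ᵛ B i

    form-by-paths : ⟦ Φ ⟧ (r ++ᵛ (a ++ᵛ b)) ≡ det (hamburgerMatrix H) * ⟦ Φ ⟧ (e ++ᵛ h)
    form-by-paths = begin
      ⟦ Φ ⟧ (r ++ᵛ (a ++ᵛ b))
        ≡⟨ cong-rows (fixLower (a ++ᵛ b) Φ) r-blocks ⟩
      ⟦ Φ ⟧ ((r₁ ++ᵛ r₂) ++ᵛ (a ++ᵛ b))
        ≡⟨ add-negligible-++ (fixLower (a ++ᵛ b) Φ)
             {y₁} {r₁} {λ u c → sum (λ i → 𝟙 (v i ≟ u) * b i c)}
             {y₂} {r₂} {λ u c → -1ℤ * sum (λ i → 𝟙 (w i ≟ u) * a i c)}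
             (λ u → negligible-sum (λ i → 𝟙 (v i ≟ u)) (negligible-↑ʳ a b))
             (λ u → negligible-scale -1ℤ (negligible-sum (λ i → 𝟙 (w i ≟ u)) (negligible-↑ˡ a b)))
             r₁-y₁ r₂-y₂ ⟩
      ⟦ Φ ⟧ ((y₁ ++ᵛ y₂) ++ᵛ (a ++ᵛ b))
        -- With the crossing edges gone, `y₁` involves only vectors of G₁ and f, and `y₂` only those
        -- of G₂ and g; each graph is reduced while the rows of the other are frozen.
        ≡⟨ form-stepRow-acyclic G₁ G₁-acyclic (Φ₁ y₂) p₁ ⟩
      ⟦ Φ ⟧ ((p₁ ++ᵛ y₂) ++ᵛ (a ++ᵛ b))
        ≡⟨ form-stepRow-acyclic G₂ G₂-acyclic (Φ₂ p₁) p₂ ⟩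
      ⟦ Φ ⟧ (p ++ᵛ (a ++ᵛ b))
        ≡⟨ add-negligible-++ (fixUpper p Φ) {q₁} {a} {λ i c → -1ℤ * p₁ (v i) c} {q₂} {b} {λ i c → -1ℤ * p₂ (w i) c}
             (λ i → negligible-scale -1ℤ (negligible-inG₁ p₁ p₂ (v i)))
             (λ i → negligible-scale -1ℤ (negligible-inG₂ p₁ p₂ (w i)))
             (λ i c → cancel (g i c) (e₁ (v i) c) (sum (λ j → A i j * f j c)))
             (λ i c → cancel′ (- f i c) (e₂ (w i) c) (sum (λ j → B i j * g j c))) ⟩
      ⟦ Φ ⟧ (p ++ᵛ (q₁ ++ᵛ q₂))
        ≡⟨ cong-rows (fixUpper p Φ) Mh-blocks ⟨
      ⟦ Φ ⟧ (p ++ᵛ Mh)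
        ≡⟨ form-det (fixUpper p Φ) h M ⟩
      det M * ⟦ Φ ⟧ (p ++ᵛ h)
        -- Now that f and g occur as rows, the path sums that turned `e` into `p` are negligible and
        -- can be taken back.
        ≡⟨ cong (det M *_) (add-negligible-++ (fixLower h Φ)
             {e₁} {p₁} {λ u c → sum (λ j → + #paths G₁ u (v j) * f j c)}
             {e₂} {p₂} {λ u c → sum (λ j → + #paths G₂ u (w j) * g j c)}
             (λ u → negligible-sum (λ j → + #paths G₁ u (v j)) (negligible-↑ˡ f g))
             (λ u → negligible-sum (λ j → + #paths G₂ u (w j)) (negligible-↑ʳ f g))
             (λ u c → refl) (λ u c → refl)) ⟩
      det M * ⟦ Φ ⟧ (e ++ᵛ h) ∎
      where
      p : Vertex → C → ℤ
      p = p₁ ++ᵛ p₂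
      cancel : ∀ x y z → x - y ≡ z + x + -1ℤ * (y + z)
      cancel = solve-∀
      cancel′ : ∀ x y z → x - y ≡ x + z + -1ℤ * (y + z)
      cancel′ = solve-∀

  -- The two evaluations share the value of the form on the vectors e, f, g. For the determinant of
  -- size N and the rows of the identity matrix this value is 1, so the two coefficients agree.
  cycleSum-det : cycleSum full (cycles graph) ≡ det (hamburgerMatrix H)
  cycleSum-det = begin
    cycleSum full (cycles graph)
      ≡⟨ trans (cong (cycleSum full (cycles graph) *_) normalised) (*-identityʳ (cycleSum full (cycles graph))) ⟨
    cycleSum full (cycles graph) * det ((e₁ ++ᵛ e₂) ++ᵛ (f ++ᵛ g))
      ≡⟨ form-by-cycles (detForm N) e₁ e₂ f g ⟨
    det (stepRow graph crossingWeight (fixLower ((λ i c → g i c - e₁ (v i) c) ++ᵛ (λ i c → - f i c - e₂ (w i) c)) (detForm N)) (e₁ ++ᵛ e₂)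
         ++ᵛ ((λ i c → g i c - e₁ (v i) c) ++ᵛ (λ i c → - f i c - e₂ (w i) c)))
      ≡⟨ form-by-paths (detForm N) e₁ e₂ f g ⟩
    det (hamburgerMatrix H) * det ((e₁ ++ᵛ e₂) ++ᵛ (f ++ᵛ g))
      ≡⟨ trans (cong (det (hamburgerMatrix H) *_) normalised) (*-identityʳ (det (hamburgerMatrix H))) ⟩
    det (hamburgerMatrix H) ∎
    where
    open ≡-Reasoning
    N = #V ℕ.+ (k ℕ.+ k)
    e₁ : G₁.Vertex → Fin N → ℤ
    e₁ u = I (inG₁ u ↑ˡ (k ℕ.+ k))
    e₂ : G₂.Vertex → Fin N → ℤ
    e₂ u = I (inG₂ u ↑ˡ (k ℕ.+ k))
    f g : Fin k → Fin N → ℤ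
    f i = I (#V ↑ʳ (i ↑ˡ k))
    g i = I (#V ↑ʳ (k ↑ʳ i))
    normalised : det ((e₁ ++ᵛ e₂) ++ᵛ (f ++ᵛ g)) ≡ 1ℤ
    normalised = trans (det-cong (≋-by-blocks {m = #V}
      (λ u c → trans (++-at-↑ˡ (e₁ ++ᵛ e₂) (f ++ᵛ g) u c)
        (≋-by-blocks {m = G₁.#V} {M = e₁ ++ᵛ e₂} {N = λ u → I (u ↑ˡ (k ℕ.+ k))} (++-at-↑ˡ e₁ e₂) (++-at-↑ʳ e₁ e₂) u c))
      (λ i c → trans (++-at-↑ʳ (e₁ ++ᵛ e₂) (f ++ᵛ g) i c)
        (≋-by-blocks {m = k} {M = f ++ᵛ g} {N = λ i → I (#V ↑ʳ i)} (++-at-↑ˡ f g) (++-at-↑ʳ f g) i c))))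
      (det-identity N)

theorem1p1 : (k : ℕ) (H : HamburgerGraph k) →
    det (hamburgerMatrix H) ≡ + HamburgerGraph.c⁺ H - + HamburgerGraph.c⁻ H
theorem1p1 k H = trans (sym (cycleSum-det H)) (cycleSum-c⁺-c⁻ H)
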